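{- No polynomial-time algorithm can solve the Minimum Cooperative Cut problem with an approximation factor of $o(\sqrt{|\mathcal{V}|/\log|\mathcal{V}|})$, where the submodular cost function is accessible only through a value oracle.
   Context: Minimum Cooperative Cut (MinCoopCut): given a directed graph $\mathcal{G}=(\mathcal{V},\mathcal{E})$ with terminal nodes $s,t\in\mathcal{V}$ and a normalized ($f(\emptyset)=0$), nonnegative, monotone nondecreasing submodular function $f:2^{\mathcal{E}}\to\mathbb{R}_+$, find an $(s,t)$-cut $C\subseteq\mathcal{E}$ minimizing $f(C)$. An $(s,t)$-cut is a set of edges whose removal disconnects all paths from $s$ to $t$. In the value oracle model, the algorithm may query $f(Q)$ for any $Q\subseteq\mathcal{E}$, and its running time counts the number of such queries. -}

module Defs where

open import Data.Fin using (Fin)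
open import Data.Fin.Subset using (Subset; ⊥; _∉_; _⊆_; _∩_; _∪_)
open import Data.Integer as ℤ using (+_)
import Data.Integer.Properties as ℤ
open import Data.Nat as ℕ using (ℕ; zero; suc; z≤n; s≤s)
import Data.Nat.DivMod as ℕ
open import Data.Nat.Logarithm using (⌊log₂_⌋)
import Data.Nat.Properties as ℕ
import Data.Nat.Solver as ℕ
open import Data.Product using (∃-syntax; _×_; _,_)
open import Data.Rational as ℚ using (ℚ; mkℚ; 0ℚ; 1ℚ)
import Data.Rational.Properties as ℚ
import Data.Rational.Solver as ℚ
import Data.Rational.Unnormalised as ℚᵘ
import Data.Rational.Unnormalised.Properties as ℚᵘ
open import Data.Sum using (inj₁; inj₂)
open import Function.Definitions using (Injective)
open import Relation.Binary.Construct.Closure.ReflexiveTransitive using (Star)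
open import Relation.Binary.PropositionalEquality
  using (_≡_; _≢_; refl; sym; trans; cong; cong₂; subst; subst₂; module ≡-Reasoning)
open import Relation.Nullary using (¬_; yes; no)

-- Real numbers: Cauchy sequences of rationals, compared by _≈_ and not by _≡_.

Cauchy : (ℕ → ℚ) → Set
Cauchy s = ∀ ε → 0ℚ ℚ.< ε →
  ∃[ N ] (∀ m n → N ℕ.≤ m → N ℕ.≤ n → ℚ.∣ s m ℚ.- s n ∣ ℚ.≤ ε)

record ℝ : Set where
  constructor mkℝ
  field
    seq    : ℕ → ℚ
    cauchy : Cauchy seq
open ℝ public

infix 4 _≤_ _≈_

_≤_ : ℝ → ℝ → Set
x ≤ y = ∀ ε → 0ℚ ℚ.< ε → ∃[ N ] (∀ n → N ℕ.≤ n → seq x n ℚ.≤ seq y n ℚ.+ ε)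

_≈_ : ℝ → ℝ → Set
x ≈ y = x ≤ y × y ≤ x

fromℚ : ℚ → ℝ
fromℚ q = mkℝ (λ _ → q) λ ε 0<ε → 0 , λ _ _ _ _ →
  subst (ℚ._≤ ε) (sym (cong ℚ.∣_∣ (ℚ.+-inverseʳ q))) (ℚ.<⇒≤ 0<ε)

0ℝ : ℝ
0ℝ = fromℚ 0ℚ

halve : ∀ ε → 0ℚ ℚ.< ε → ∃[ δ ] (0ℚ ℚ.< δ × δ ℚ.+ δ ≡ ε)
halve ε 0<ε = ℚ.½ ℚ.* ε ,
  subst (ℚ._< ℚ.½ ℚ.* ε) (ℚ.*-zeroʳ ℚ.½) (ℚ.*-monoʳ-<-pos ℚ.½ 0<ε) ,
  trans (sym (ℚ.*-distribʳ-+ ε ℚ.½ ℚ.½)) (ℚ.*-identityˡ ε)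

scale : ∀ B ε → 0ℚ ℚ.< B → 0ℚ ℚ.< ε → ∃[ δ ] (0ℚ ℚ.< δ × B ℚ.* δ ≡ ε)
scale B ε 0<B 0<ε = (1/B ℚ.* ε) ,
  subst (ℚ._< 1/B ℚ.* ε) (ℚ.*-zeroʳ 1/B) (ℚ.*-monoʳ-<-pos 1/B 0<ε) ,
  trans (sym (ℚ.*-assoc B 1/B ε))
    (trans (cong (ℚ._* ε) (ℚ.*-inverseʳ B)) (ℚ.*-identityˡ ε))
  where
  instance
    B-pos : ℚ.Positive B
    B-pos = ℚ.positive 0<B
    B-nz : ℚ.NonZero B
    B-nz = ℚ.pos⇒nonZero B
  1/B : ℚ
  1/B = ℚ.1/ B
  instance
    1/B-pos : ℚ.Positive 1/B
    1/B-pos = ℚ.1/pos⇒pos B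

bound : (x : ℝ) → ∃[ B ] ∃[ N ] (0ℚ ℚ.< B × (∀ n → N ℕ.≤ n → ℚ.∣ seq x n ∣ ℚ.≤ B))
bound x with cauchy x 1ℚ (ℚ.positive⁻¹ 1ℚ)
... | N , close = 1ℚ ℚ.+ ℚ.∣ seq x N ∣ , N ,
  ℚ.+-mono-<-≤ (ℚ.positive⁻¹ 1ℚ) (ℚ.0≤∣p∣ (seq x N)) , below
  where
  open ℚ.≤-Reasoning
  open ℚ.+-*-Solver
  below : ∀ n → N ℕ.≤ n → ℚ.∣ seq x n ∣ ℚ.≤ 1ℚ ℚ.+ ℚ.∣ seq x N ∣
  below n N≤n = begin
    ℚ.∣ a ∣                   ≡⟨ cong ℚ.∣_∣ (solve 2 (λ a b → a := (a :- b) :+ b) refl a b) ⟩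
    ℚ.∣ a ℚ.- b ℚ.+ b ∣       ≤⟨ ℚ.∣p+q∣≤∣p∣+∣q∣ (a ℚ.- b) b ⟩
    ℚ.∣ a ℚ.- b ∣ ℚ.+ ℚ.∣ b ∣ ≤⟨ ℚ.+-monoˡ-≤ ℚ.∣ b ∣ (close n N N≤n ℕ.≤-refl) ⟩
    1ℚ ℚ.+ ℚ.∣ b ∣            ∎
    where
    a b : ℚ
    a = seq x n
    b = seq x N

*-≤ : ∀ a b {c d} → 0ℚ ℚ.≤ c → 0ℚ ℚ.≤ b → a ℚ.≤ c → b ℚ.≤ d → a ℚ.* b ℚ.≤ c ℚ.* d
*-≤ a b {c} {d} 0≤c 0≤b a≤c b≤d = ℚ.≤-trans
  (ℚ.*-monoʳ-≤-nonNeg b {{ℚ.nonNegative 0≤b}} a≤c)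
  (ℚ.*-monoˡ-≤-nonNeg c {{ℚ.nonNegative 0≤c}} b≤d)

product-difference : ∀ a b c d →
  a ℚ.* b ℚ.- c ℚ.* d ≡ a ℚ.* (b ℚ.- d) ℚ.+ d ℚ.* (a ℚ.- c)
product-difference a b c d = begin
  a ℚ.* b ℚ.- c ℚ.* d
    ≡⟨ telescope (a ℚ.* b) (a ℚ.* d) (c ℚ.* d) ⟨
  (a ℚ.* b ℚ.- a ℚ.* d) ℚ.+ (a ℚ.* d ℚ.- c ℚ.* d)
    ≡⟨ cong₂ (λ x y → (a ℚ.* b ℚ.- a ℚ.* d) ℚ.+ (x ℚ.- y)) (ℚ.*-comm a d) (ℚ.*-comm c d) ⟩
  (a ℚ.* b ℚ.- a ℚ.* d) ℚ.+ (d ℚ.* a ℚ.- d ℚ.* c)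
    ≡⟨ cong₂ ℚ._+_ (*-distrib-- a b d) (*-distrib-- d a c) ⟨
  a ℚ.* (b ℚ.- d) ℚ.+ d ℚ.* (a ℚ.- c) ∎
  where
  open ≡-Reasoning
  telescope : ∀ u v w → (u ℚ.- v) ℚ.+ (v ℚ.- w) ≡ u ℚ.- w
  telescope = solve 3 (λ u v w → (u :- v) :+ (v :- w) := u :- w) refl
    where open ℚ.+-*-Solver
  *-distrib-- : ∀ u v w → u ℚ.* (v ℚ.- w) ≡ u ℚ.* v ℚ.- u ℚ.* w
  *-distrib-- u v w = trans (ℚ.*-distribˡ-+ u v (ℚ.- w))
    (cong (u ℚ.* v ℚ.+_) (sym (ℚ.neg-distribʳ-* u w)))

product-close : ∀ a b c d A B δ → 0ℚ ℚ.≤ A → 0ℚ ℚ.≤ B →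
  ℚ.∣ a ∣ ℚ.≤ A → ℚ.∣ d ∣ ℚ.≤ B → ℚ.∣ a ℚ.- c ∣ ℚ.≤ δ → ℚ.∣ b ℚ.- d ∣ ℚ.≤ δ →
  ℚ.∣ a ℚ.* b ℚ.- c ℚ.* d ∣ ℚ.≤ (A ℚ.+ B) ℚ.* δ
product-close a b c d A B δ 0≤A 0≤B ∣a∣≤A ∣d∣≤B ac bd =
  subst₂ ℚ._≤_ (cong ℚ.∣_∣ (sym (product-difference a b c d))) (sym (ℚ.*-distribʳ-+ δ A B))
    (ℚ.≤-trans (ℚ.∣p+q∣≤∣p∣+∣q∣ (a ℚ.* (b ℚ.- d)) (d ℚ.* (a ℚ.- c)))
      (ℚ.+-mono-≤
        (subst (ℚ._≤ A ℚ.* δ) (sym (ℚ.∣p*q∣≡∣p∣*∣q∣ a (b ℚ.- d)))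
          (*-≤ ℚ.∣ a ∣ ℚ.∣ b ℚ.- d ∣ 0≤A (ℚ.0≤∣p∣ (b ℚ.- d)) ∣a∣≤A bd))
        (subst (ℚ._≤ B ℚ.* δ) (sym (ℚ.∣p*q∣≡∣p∣*∣q∣ d (a ℚ.- c)))
          (*-≤ ℚ.∣ d ∣ ℚ.∣ a ℚ.- c ∣ 0≤B (ℚ.0≤∣p∣ (a ℚ.- c)) ∣d∣≤B ac))))

infixl 6 _+_
infixl 7 _*_

_+_ : ℝ → ℝ → ℝ
x + y = mkℝ (λ n → seq x n ℚ.+ seq y n) λ ε 0<ε → close ε (halve ε 0<ε)
  where
  open ℚ.≤-Reasoning
  open ℚ.+-*-Solver
  close : ∀ ε → ∃[ δ ] (0ℚ ℚ.< δ × δ ℚ.+ δ ≡ ε) →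
    ∃[ N ] (∀ m n → N ℕ.≤ m → N ℕ.≤ n →
      ℚ.∣ (seq x m ℚ.+ seq y m) ℚ.- (seq x n ℚ.+ seq y n) ∣ ℚ.≤ ε)
  close ε (δ , 0<δ , refl) with cauchy x δ 0<δ | cauchy y δ 0<δ
  ... | M , closeˣ | N , closeʸ = M ℕ.⊔ N , λ m n p q →
    let a = seq x m; b = seq y m; c = seq x n; d = seq y n in begin
    ℚ.∣ (a ℚ.+ b) ℚ.- (c ℚ.+ d) ∣
      ≡⟨ cong ℚ.∣_∣ (solve 4 (λ a b c d →
           (a :+ b) :- (c :+ d) := (a :- c) :+ (b :- d)) refl a b c d) ⟩
    ℚ.∣ (a ℚ.- c) ℚ.+ (b ℚ.- d) ∣
      ≤⟨ ℚ.∣p+q∣≤∣p∣+∣q∣ (a ℚ.- c) (b ℚ.- d) ⟩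
    ℚ.∣ a ℚ.- c ∣ ℚ.+ ℚ.∣ b ℚ.- d ∣
      ≤⟨ ℚ.+-mono-≤
           (closeˣ m n (ℕ.≤-trans (ℕ.m≤m⊔n M N) p) (ℕ.≤-trans (ℕ.m≤m⊔n M N) q))
           (closeʸ m n (ℕ.≤-trans (ℕ.m≤n⊔m M N) p) (ℕ.≤-trans (ℕ.m≤n⊔m M N) q)) ⟩
    δ ℚ.+ δ ∎

_*_ : ℝ → ℝ → ℝ
x * y = mkℝ (λ n → seq x n ℚ.* seq y n) λ ε 0<ε → close ε 0<ε (bound x) (bound y)
  where
  Bound : ℝ → Set
  Bound z = ∃[ B ] ∃[ N ] (0ℚ ℚ.< B × (∀ n → N ℕ.≤ n → ℚ.∣ seq z n ∣ ℚ.≤ B))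

  close : ∀ ε → 0ℚ ℚ.< ε → Bound x → Bound y →
    ∃[ N ] (∀ m n → N ℕ.≤ m → N ℕ.≤ n →
      ℚ.∣ seq x m ℚ.* seq y m ℚ.- seq x n ℚ.* seq y n ∣ ℚ.≤ ε)
  close ε 0<ε (A , K , 0<A , boundˣ) (B , L , 0<B , boundʸ) =
    let δ , 0<δ , eq = scale (A ℚ.+ B) ε (ℚ.+-mono-< 0<A 0<B) 0<ε
        M , closeˣ = cauchy x δ 0<δ
        N , closeʸ = cauchy y δ 0<δ
    in (K ℕ.⊔ L) ℕ.⊔ (M ℕ.⊔ N) , λ m n p q → subst (_ ℚ.≤_) eq
      (product-close (seq x m) (seq y m) (seq x n) (seq y n) A B δ
        (ℚ.<⇒≤ 0<A) (ℚ.<⇒≤ 0<B)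
        (boundˣ m (ℕ.m⊔n≤o⇒m≤o K L (ℕ.m⊔n≤o⇒m≤o (K ℕ.⊔ L) (M ℕ.⊔ N) p)))
        (boundʸ n (ℕ.m⊔n≤o⇒n≤o K L (ℕ.m⊔n≤o⇒m≤o (K ℕ.⊔ L) (M ℕ.⊔ N) q)))
        (closeˣ m n (ℕ.m⊔n≤o⇒m≤o M N (ℕ.m⊔n≤o⇒n≤o (K ℕ.⊔ L) (M ℕ.⊔ N) p))
                    (ℕ.m⊔n≤o⇒m≤o M N (ℕ.m⊔n≤o⇒n≤o (K ℕ.⊔ L) (M ℕ.⊔ N) q)))
        (closeʸ m n (ℕ.m⊔n≤o⇒n≤o M N (ℕ.m⊔n≤o⇒n≤o (K ℕ.⊔ L) (M ℕ.⊔ N) p))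
                    (ℕ.m⊔n≤o⇒n≤o M N (ℕ.m⊔n≤o⇒n≤o (K ℕ.⊔ L) (M ℕ.⊔ N) q))))

∣-∣-≤ : ∀ {p q} → p ℚ.≤ q → ℚ.- p ℚ.≤ q → ℚ.∣ p ∣ ℚ.≤ q
∣-∣-≤ {p} p≤q -p≤q with ℚ.∣p∣≡p∨∣p∣≡-p p
... | inj₁ eq = subst (ℚ._≤ _) (sym eq) p≤q
... | inj₂ eq = subst (ℚ._≤ _) (sym eq) -p≤q

≤-+⇒-≤ : ∀ a b {c} → a ℚ.≤ b ℚ.+ c → a ℚ.- b ℚ.≤ c
≤-+⇒-≤ a b {c} h = subst (a ℚ.- b ℚ.≤_)
  (solve 2 (λ b c → b :+ c :- b := c) refl b c) (ℚ.+-monoˡ-≤ (ℚ.- b) h)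
  where open ℚ.+-*-Solver

flip- : ∀ a b → ℚ.- (a ℚ.- b) ≡ b ℚ.- a
flip- = solve 2 (λ a b → :- (a :- b) := b :- a) refl
  where open ℚ.+-*-Solver

∣-∣-diff : ∀ a b → ℚ.∣ a ∣ ℚ.≤ ℚ.∣ b ∣ ℚ.+ ℚ.∣ a ℚ.- b ∣
∣-∣-diff a b = subst (λ z → ℚ.∣ z ∣ ℚ.≤ ℚ.∣ b ∣ ℚ.+ ℚ.∣ a ℚ.- b ∣)
  (solve 2 (λ a b → b :+ (a :- b) := a) refl a b) (ℚ.∣p+q∣≤∣p∣+∣q∣ b (a ℚ.- b))
  where open ℚ.+-*-Solver

reverse-triangle : ∀ a b → ℚ.∣ ℚ.∣ a ∣ ℚ.- ℚ.∣ b ∣ ∣ ℚ.≤ ℚ.∣ a ℚ.- b ∣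
reverse-triangle a b = ∣-∣-≤ (≤-+⇒-≤ ℚ.∣ a ∣ ℚ.∣ b ∣ (∣-∣-diff a b))
  (subst₂ ℚ._≤_ (sym (flip- ℚ.∣ a ∣ ℚ.∣ b ∣))
    (trans (cong ℚ.∣_∣ (sym (flip- a b))) (ℚ.∣-p∣≡∣p∣ (a ℚ.- b)))
    (≤-+⇒-≤ ℚ.∣ b ∣ ℚ.∣ a ∣ (∣-∣-diff b a)))

∣_∣ : ℝ → ℝ
∣ x ∣ = mkℝ (λ n → ℚ.∣ seq x n ∣) λ ε 0<ε →
  let N , close = cauchy x ε 0<ε in
  N , λ m n p q → ℚ.≤-trans (reverse-triangle (seq x m) (seq x n)) (close m n p q)

⌊√_⌋ : ℕ → ℕ
⌊√ zero ⌋  = zero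
⌊√ suc n ⌋ with suc ⌊√ n ⌋ ℕ.* suc ⌊√ n ⌋ ℕ.≤? suc n
... | yes _ = suc ⌊√ n ⌋
... | no  _ = ⌊√ n ⌋

⌊√⌋-lower : ∀ n → ⌊√ n ⌋ ℕ.* ⌊√ n ⌋ ℕ.≤ n
⌊√⌋-lower zero = z≤n
⌊√⌋-lower (suc n) with suc ⌊√ n ⌋ ℕ.* suc ⌊√ n ⌋ ℕ.≤? suc n
... | yes p = p
... | no  _ = ℕ.m≤n⇒m≤1+n (⌊√⌋-lower n)

⌊√⌋-upper : ∀ n → n ℕ.< suc ⌊√ n ⌋ ℕ.* suc ⌊√ n ⌋
⌊√⌋-upper zero = s≤s z≤n
⌊√⌋-upper (suc n) with suc ⌊√ n ⌋ ℕ.* suc ⌊√ n ⌋ ℕ.≤? suc n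
... | yes _ = ℕ.≤-<-trans (⌊√⌋-upper n)
                (ℕ.*-mono-< (ℕ.n<1+n (suc ⌊√ n ⌋)) (ℕ.n<1+n (suc ⌊√ n ⌋)))
... | no  p = ℕ.≰⇒> p

square-cancel-< : ∀ a b → a ℕ.* a ℕ.< b ℕ.* b → a ℕ.< b
square-cancel-< a b h = ℕ.≰⇒> λ b≤a → ℕ.<⇒≱ h (ℕ.*-mono-≤ b≤a b≤a)

module Root (p q : ℕ) .{{_ : ℕ.NonZero q}} where
  quot root : ℕ → ℕ
  quot k = p ℕ.* (suc k ℕ.* suc k) ℕ./ q
  root k = ⌊√ quot k ⌋

  approx : ℕ → ℚ
  approx k = + root k ℚ./ suc k

  lower : ∀ k → (root k ℕ.* root k) ℕ.* q ℕ.≤ p ℕ.* (suc k ℕ.* suc k)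
  lower k = ℕ.≤-trans (ℕ.*-monoˡ-≤ q (⌊√⌋-lower (quot k)))
              (ℕ.m/n*n≤m (p ℕ.* (suc k ℕ.* suc k)) q)

  upper : ∀ k → p ℕ.* (suc k ℕ.* suc k) ℕ.< (suc (root k) ℕ.* suc (root k)) ℕ.* q
  upper k = ℕ.<-≤-trans
    (subst₂ ℕ._<_ (sym (ℕ.m≡m%n+[m/n]*n N q)) refl
      (ℕ.+-monoˡ-< (quot k ℕ.* q) (ℕ.m%n<n N q)))
    (ℕ.*-monoˡ-≤ q (⌊√⌋-upper (quot k)))
    where
    N : ℕ
    N = p ℕ.* (suc k ℕ.* suc k)

  cross : ∀ j k → root j ℕ.* suc k ℕ.< suc (root k) ℕ.* suc j
  cross j k = square-cancel-< _ _ (ℕ.*-cancelʳ-< _ _ _ (begin-strict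
    (a ℕ.* K) ℕ.* (a ℕ.* K) ℕ.* q
      ≡⟨ solve 3 (λ a K q → (a :* K) :* (a :* K) :* q := (a :* a) :* q :* (K :* K)) refl a K q ⟩
    (a ℕ.* a) ℕ.* q ℕ.* (K ℕ.* K)
      ≤⟨ ℕ.*-monoˡ-≤ (K ℕ.* K) (lower j) ⟩
    p ℕ.* (J ℕ.* J) ℕ.* (K ℕ.* K)
      ≡⟨ solve 3 (λ p J K → p :* (J :* J) :* (K :* K) := p :* (K :* K) :* (J :* J)) refl p J K ⟩
    p ℕ.* (K ℕ.* K) ℕ.* (J ℕ.* J)
      <⟨ ℕ.*-monoˡ-< (J ℕ.* J) (upper k) ⟩
    (b ℕ.* b) ℕ.* q ℕ.* (J ℕ.* J)
      ≡⟨ solve 3 (λ b J q → (b :* b) :* q :* (J :* J) := (b :* J) :* (b :* J) :* q) refl b J q ⟩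
    (b ℕ.* J) ℕ.* (b ℕ.* J) ℕ.* q ∎))
    where
    open ℕ.≤-Reasoning
    open ℕ.+-*-Solver
    a b J K : ℕ
    a = root j
    b = suc (root k)
    J = suc j
    K = suc k

  step : ∀ j k → approx j ℚ.≤ approx k ℚ.+ + 1 ℚ./ suc k
  step j k = ℚ.toℚᵘ-cancel-≤ (begin
    ℚ.toℚᵘ (approx j)
      ≃⟨ ℚ.toℚᵘ-fromℚᵘ (ℚᵘ.mkℚᵘ (+ root j) j) ⟩
    ℚᵘ.mkℚᵘ (+ root j) j
      ≤⟨ ℚᵘ.*≤* (subst₂ ℤ._≤_ (ℤ.pos-* (root j) (suc k)) (ℤ.pos-* (suc (root k)) (suc j))
           (ℤ.+≤+ (ℕ.<⇒≤ (cross j k)))) ⟩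
    ℚᵘ.mkℚᵘ (+ suc (root k)) k
      ≃⟨ ℚᵘ.*≡* (trans (sym (ℤ.pos-* (suc (root k)) (suc k ℕ.* suc k))) (trans (cong +_ eq)
           (trans (ℤ.pos-* (root k ℕ.* suc k ℕ.+ 1 ℕ.* suc k) (suc k))
             (cong (ℤ._* + suc k) (cong₂ ℤ._+_ (ℤ.pos-* (root k) (suc k)) (ℤ.pos-* 1 (suc k))))))) ⟩
    ℚᵘ.mkℚᵘ (+ root k) k ℚᵘ.+ ℚᵘ.mkℚᵘ (+ 1) k
      ≃⟨ ℚᵘ.+-cong (ℚ.toℚᵘ-fromℚᵘ (ℚᵘ.mkℚᵘ (+ root k) k)) (ℚ.toℚᵘ-fromℚᵘ (ℚᵘ.mkℚᵘ (+ 1) k)) ⟨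
    ℚ.toℚᵘ (approx k) ℚᵘ.+ ℚ.toℚᵘ (+ 1 ℚ./ suc k)
      ≃⟨ ℚ.toℚᵘ-homo-+ (approx k) (+ 1 ℚ./ suc k) ⟨
    ℚ.toℚᵘ (approx k ℚ.+ + 1 ℚ./ suc k) ∎)
    where
    open ℚᵘ.≤-Reasoning
    open ℕ.+-*-Solver
    eq : suc (root k) ℕ.* (suc k ℕ.* suc k) ≡ (root k ℕ.* suc k ℕ.+ 1 ℕ.* suc k) ℕ.* suc k
    eq = solve 2 (λ r K → (con 1 :+ r) :* (K :* K) := (r :* K :+ con 1 :* K) :* K)
           refl (root k) (suc k)

  small : ∀ ε → 0ℚ ℚ.< ε → ∃[ N ] (∀ k → N ℕ.≤ k → + 1 ℚ./ suc k ℚ.≤ ε)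
  small ε@(mkℚ (+ suc a) d _) 0<ε = d , λ k d≤k → ℚ.toℚᵘ-cancel-≤
    (ℚᵘ.≤-respˡ-≃ (ℚᵘ.≃-sym (ℚ.toℚᵘ-fromℚᵘ (ℚᵘ.mkℚᵘ (+ 1) k)))
      (ℚᵘ.*≤* (subst₂ ℤ._≤_ (ℤ.pos-* 1 (suc d)) (ℤ.pos-* (suc a) (suc k))
        (ℤ.+≤+ (ℕ.*-mono-≤ (s≤s (z≤n {a})) (s≤s d≤k))))))
  small (mkℚ (+ zero) _ _) (ℚ.*<* (ℤ.+<+ ()))
  small (mkℚ (ℤ.-[1+ _ ]) _ _) (ℚ.*<* ())

  approx-cauchy : Cauchy approx
  approx-cauchy ε 0<ε with small ε 0<ε
  ... | N , tiny = N , λ m n p q → ∣-∣-≤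
    (≤-+⇒-≤ (approx m) (approx n)
      (ℚ.≤-trans (step m n) (ℚ.+-monoʳ-≤ (approx n) (tiny n q))))
    (subst (ℚ._≤ ε) (sym (flip- (approx m) (approx n)))
      (≤-+⇒-≤ (approx n) (approx m)
        (ℚ.≤-trans (step n m) (ℚ.+-monoʳ-≤ (approx m) (tiny m p)))))

-- The real number √(p/q), as the limit of ⌊(k+1)√(p/q)⌋ / (k+1);
-- by convention it is 0 when q = 0.
√[_/_] : ℕ → ℕ → ℝ
√[ p / zero ]      = 0ℝ
√[ p / q@(suc _) ] = mkℝ (Root.approx p q) (Root.approx-cauchy p q)

infix 4 _∈o_

_∈o_ : (ℕ → ℝ) → (ℕ → ℝ) → Set
f ∈o g = ∀ ε → 0ℚ ℚ.< ε → ∃[ N ] (∀ n → N ℕ.≤ n → ∣ f n ∣ ≤ fromℚ ε * g n)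

-- Without s ≢ t no (s,t)-cut would exist.
record Network : Set where
  field
    ∣V∣ ∣E∣    : ℕ
    edge       : Fin ∣E∣ → Fin ∣V∣ × Fin ∣V∣
    edge-inj   : Injective _≡_ _≡_ edge
    s t        : Fin ∣V∣
    s≢t        : s ≢ t

  Vertex : Set
  Vertex = Fin ∣V∣

  EdgeSet : Set
  EdgeSet = Subset ∣E∣

  StepAvoiding : EdgeSet → Vertex → Vertex → Set
  StepAvoiding C u v = ∃[ e ] (e ∉ C × edge e ≡ (u , v))

  IsCut : EdgeSet → Set
  IsCut C = ¬ Star (StepAvoiding C) s t
open Network public

record CostFunction (m : ℕ) : Set where
  field
    cost       : Subset m → ℝ
    normalized : cost ⊥ ≈ 0ℝ
    nonneg     : ∀ A → 0ℝ ≤ cost A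
    monotone   : ∀ A B → A ⊆ B → cost A ≤ cost B
    submodular : ∀ A B → cost (A ∪ B) + cost (A ∩ B) ≤ cost A + cost B
open CostFunction public

IsMinCut : (I : Network) → CostFunction (∣E∣ I) → EdgeSet I → Set
IsMinCut I f C = IsCut I C × (∀ D → IsCut I D → cost f C ≤ cost f D)

-- A computation that adaptively queries a value oracle on subsets of an m-element
-- set; only queries are charged, everything between two queries is free.
data OracleComputation (m : ℕ) : Set where
  return : Subset m → OracleComputation m
  query  : Subset m → (ℝ → OracleComputation m) → OracleComputation m

module _ {m : ℕ} (oracle : Subset m → ℝ) where
  result : OracleComputation m → Subset m
  result (return C)  = C
  result (query Q k) = result (k (oracle Q))

  queries : OracleComputation m → ℕ
  queries (return C)  = 0
  queries (query Q k) = suc (queries (k (oracle Q)))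

Algorithm : Set
Algorithm = (I : Network) → OracleComputation (∣E∣ I)

PolynomialTime : Algorithm → Set
PolynomialTime A = ∃[ c ] ∃[ d ] (∀ (I : Network) (f : CostFunction (∣E∣ I)) →
  queries (cost f) (A I) ℕ.≤ c ℕ.* (∣V∣ I ℕ.+ ∣E∣ I) ℕ.^ d)

HasApproximationFactor : Algorithm → (ℕ → ℝ) → Set
HasApproximationFactor A α = ∀ (I : Network) (f : CostFunction (∣E∣ I)) →
  let C = result (cost f) (A I) in
  IsCut I C × (∀ C* → IsMinCut I f C* → cost f C ≤ α (∣V∣ I) * cost f C*)

-- Rounding the logarithm changes √(n / log n) only by a bounded factor.
√[n/logn] : ℕ → ℝ
√[n/logn] n = √[ n / ⌊log₂ n ⌋ ]

{-# OPTIONS --safe #-}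

-- Take k disjoint s-t paths of ℓ edges each.  A cut R with one edge per path can be hidden in
-- the cost min(|Q \ R| + min(|Q ∩ R|, β), k): it differs from min(|Q|, k) only at sets with
-- |Q| ≤ 2k and |Q ∩ R| > β.  For uniformly random R and a fixed Q with |Q| ≤ 2k, the mean of
-- 2^|Q ∩ R| is at most (1 + 1/ℓ)^2k, so for ℓ = 2^j, k = ℓ j and β a suitable multiple of j some
-- R escapes the polynomially many queries made against min(|Q|, k).  The algorithm then answers
-- with a cut of cost k although R costs at most β.
module Submission where

open import Defs
open import Data.Bool using (Bool; true; false; if_then_else_; _∧_; _∨_)
open import Data.Fin as Fin using (Fin; zero; suc; inject₁; fromℕ; toℕ; combine; remQuot; punchIn)
import Data.Fin.Properties as Fin
open import Data.Fin.Relation.Unary.Top using (View; view; ‵fromℕ; ‵inj₁; view-fromℕ)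
open import Data.Fin.Subset using (Subset; ⊥; _∉_; _⊆_; _∩_; _∪_)
open import Data.Fin.Subset.Properties using (p∩q⊆p; p∩q⊆q)
import Data.Integer as ℤ
import Data.Integer.Properties as ℤ
open import Data.List using (List; []; _∷_; length; filter; map)
open import Data.List.Properties using (length-filter; length-map)
open import Data.List.Membership.Propositional.Properties using (∈-filter⁺; ∈-map⁺)
open import Data.List.Relation.Unary.All.Properties using (all-filter)
open import Data.List.Membership.Propositional using (_∈_)
open import Data.List.Relation.Unary.All as All using (All; []; _∷_)
open import Data.List.Relation.Unary.Any using (here; there)
open import Data.Nat as ℕ using (ℕ; zero; suc; z≤n; s≤s; _⊓_; _^_; _∸_)
import Data.Nat.Properties as ℕ
open import Data.Nat.Logarithm using (⌊log₂_⌋; ⌊log₂⌋-mono-≤; ⌊log₂[2^n]⌋≡n)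
import Data.Nat.Solver as ℕ
open import Data.Product using (∃-syntax; _×_; _,_; proj₁; proj₂; uncurry)
open import Data.Rational as ℚ using (ℚ; 0ℚ; 1ℚ)
import Data.Rational.Properties as ℚ
import Data.Rational.Solver as ℚ
import Data.Rational.Unnormalised as ℚᵘ
import Data.Rational.Unnormalised.Properties as ℚᵘ
open import Data.Sum using (_⊎_; inj₁; inj₂)
open import Data.Vec as Vec using (Vec; []; _∷_; lookup; tabulate)
import Data.Vec.Properties as Vec
open import Algebra.Properties.Semiring.Sum ℕ.+-*-semiring
  using (sum; sum-cong-≗; sum-remove; ∑-distrib-+; *-distribˡ-sum; *-distribʳ-sum)
open import Function using (_∘_)
open import Relation.Binary.Construct.Closure.ReflexiveTransitive using (Star; _◅_) renaming (ε to stop)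
open import Relation.Binary.PropositionalEquality
  using (_≡_; _≢_; refl; sym; trans; cong; cong₂; subst; subst₂; module ≡-Reasoning)
open import Relation.Nullary using (¬_; Dec; yes; no; does; contradiction)
open import Relation.Nullary.Decidable using (dec-true; dec-false)

-- Natural numbers inside `ℚ` and `ℝ`.

⌜_⌝ : ℕ → ℚ
⌜ n ⌝ = ℤ.+ n ℚ./ 1

toℚᵘ-⌜⌝ : ∀ n → ℚ.toℚᵘ ⌜ n ⌝ ℚᵘ.≃ ℚᵘ.mkℚᵘ (ℤ.+ n) 0
toℚᵘ-⌜⌝ n = ℚ.toℚᵘ-fromℚᵘ (ℚᵘ.mkℚᵘ (ℤ.+ n) 0)

⌜⌝-mono-≤ : ∀ {a b} → a ℕ.≤ b → ⌜ a ⌝ ℚ.≤ ⌜ b ⌝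
⌜⌝-mono-≤ {a} {b} a≤b = ℚ.toℚᵘ-cancel-≤
  (ℚᵘ.≤-respʳ-≃ (ℚᵘ.≃-sym (toℚᵘ-⌜⌝ b)) (ℚᵘ.≤-respˡ-≃ (ℚᵘ.≃-sym (toℚᵘ-⌜⌝ a))
    (ℚᵘ.*≤* (ℤ.*-monoʳ-≤-nonNeg (ℤ.+ 1) (ℤ.+≤+ a≤b)))))

⌜⌝-cancel-≤ : ∀ {a b} → ⌜ a ⌝ ℚ.≤ ⌜ b ⌝ → a ℕ.≤ b
⌜⌝-cancel-≤ {a} {b} h with ℚᵘ.≤-respʳ-≃ (toℚᵘ-⌜⌝ b) (ℚᵘ.≤-respˡ-≃ (toℚᵘ-⌜⌝ a) (ℚ.toℚᵘ-mono-≤ h))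
... | ℚᵘ.*≤* a*1≤b*1 = ℤ.drop‿+≤+ (ℤ.*-cancelʳ-≤-pos (ℤ.+ a) (ℤ.+ b) (ℤ.+ 1) a*1≤b*1)

⌜⌝-homo-+ : ∀ a b → ⌜ a ℕ.+ b ⌝ ≡ ⌜ a ⌝ ℚ.+ ⌜ b ⌝
⌜⌝-homo-+ a b = ℚ.toℚᵘ-injective (begin
  ℚ.toℚᵘ ⌜ a ℕ.+ b ⌝                              ≈⟨ toℚᵘ-⌜⌝ (a ℕ.+ b) ⟩
  ℚᵘ.mkℚᵘ (ℤ.+ (a ℕ.+ b)) 0
    ≈⟨ ℚᵘ.*≡* (cong (ℤ._* ℤ.+ 1) (sym (cong₂ ℤ._+_ (ℤ.*-identityʳ (ℤ.+ a)) (ℤ.*-identityʳ (ℤ.+ b))))) ⟩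
  ℚᵘ.mkℚᵘ (ℤ.+ a) 0 ℚᵘ.+ ℚᵘ.mkℚᵘ (ℤ.+ b) 0        ≈⟨ ℚᵘ.+-cong (toℚᵘ-⌜⌝ a) (toℚᵘ-⌜⌝ b) ⟨
  ℚ.toℚᵘ ⌜ a ⌝ ℚᵘ.+ ℚ.toℚᵘ ⌜ b ⌝                  ≈⟨ ℚ.toℚᵘ-homo-+ ⌜ a ⌝ ⌜ b ⌝ ⟨
  ℚ.toℚᵘ (⌜ a ⌝ ℚ.+ ⌜ b ⌝)                        ∎)
  where open ℚᵘ.≃-Reasoning

⌜⌝-homo-* : ∀ a b → ⌜ a ℕ.* b ⌝ ≡ ⌜ a ⌝ ℚ.* ⌜ b ⌝
⌜⌝-homo-* a b = ℚ.toℚᵘ-injective (begin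
  ℚ.toℚᵘ ⌜ a ℕ.* b ⌝                              ≈⟨ toℚᵘ-⌜⌝ (a ℕ.* b) ⟩
  ℚᵘ.mkℚᵘ (ℤ.+ (a ℕ.* b)) 0                       ≈⟨ ℚᵘ.*≡* (cong (ℤ._* ℤ.+ 1) (ℤ.pos-* a b)) ⟩
  ℚᵘ.mkℚᵘ (ℤ.+ a) 0 ℚᵘ.* ℚᵘ.mkℚᵘ (ℤ.+ b) 0        ≈⟨ ℚᵘ.*-cong (toℚᵘ-⌜⌝ a) (toℚᵘ-⌜⌝ b) ⟨
  ℚ.toℚᵘ ⌜ a ⌝ ℚᵘ.* ℚ.toℚᵘ ⌜ b ⌝                  ≈⟨ ℚ.toℚᵘ-homo-* ⌜ a ⌝ ⌜ b ⌝ ⟨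
  ℚ.toℚᵘ (⌜ a ⌝ ℚ.* ⌜ b ⌝)                        ∎)
  where open ℚᵘ.≃-Reasoning

p≤p+ε : ∀ {p q} ε → 0ℚ ℚ.< ε → p ℚ.≤ q → p ℚ.≤ q ℚ.+ ε
p≤p+ε {p} {q} ε 0<ε p≤q =
  subst (ℚ._≤ q ℚ.+ ε) (ℚ.+-identityʳ p) (ℚ.+-mono-≤ p≤q (ℚ.<⇒≤ 0<ε))

fromℚ-mono-≤ : ∀ {p q} → p ℚ.≤ q → fromℚ p ≤ fromℚ q
fromℚ-mono-≤ p≤q ε 0<ε = 0 , λ _ _ → p≤p+ε ε 0<ε p≤q

-- Rounding down keeps every approximant, not just the limit, below u: a larger root would violate
-- `lower`. For q = 0 the root is 0 by convention.
√-seq-≤ : ∀ {p q} u → p ℕ.≤ u ℕ.* u ℕ.* q → ∀ i → seq √[ p / q ] i ℚ.≤ ⌜ u ⌝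
√-seq-≤ {q = zero} u _ i = ⌜⌝-mono-≤ {0} {u} z≤n
√-seq-≤ {p} {q@(suc _)} u p≤u²q i = ℚ.toℚᵘ-cancel-≤
  (ℚᵘ.≤-respʳ-≃ (ℚᵘ.≃-sym (toℚᵘ-⌜⌝ u))
    (ℚᵘ.≤-respˡ-≃ (ℚᵘ.≃-sym (ℚ.toℚᵘ-fromℚᵘ (ℚᵘ.mkℚᵘ (ℤ.+ root i) i)))
      (ℚᵘ.*≤* (subst₂ ℤ._≤_ (ℤ.pos-* (root i) 1) (ℤ.pos-* u (suc i))
        (ℤ.+≤+ (subst (ℕ._≤ u ℕ.* suc i) (sym (ℕ.*-identityʳ (root i))) root≤))))))
  where
  open Root p q
  open ℕ.≤-Reasoning
  open ℕ.+-*-Solver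
  root≤ : root i ℕ.≤ u ℕ.* suc i
  root≤ = ℕ.≮⇒≥ λ h → ℕ.<-irrefl refl (begin-strict
    (u ℕ.* suc i) ℕ.* (u ℕ.* suc i) ℕ.* q  <⟨ ℕ.*-monoˡ-< q (ℕ.*-mono-< h h) ⟩
    root i ℕ.* root i ℕ.* q                ≤⟨ lower i ⟩
    p ℕ.* (suc i ℕ.* suc i)                ≤⟨ ℕ.*-monoˡ-≤ (suc i ℕ.* suc i) p≤u²q ⟩
    u ℕ.* u ℕ.* q ℕ.* (suc i ℕ.* suc i)
      ≡⟨ solve 3 (λ u q x → u :* u :* q :* (x :* x) := (u :* x) :* (u :* x) :* q) refl u q (suc i) ⟩
    (u ℕ.* suc i) ℕ.* (u ℕ.* suc i) ℕ.* q  ∎)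

-- Finite sums of natural numbers.

sum-mono-≤ : ∀ {n} {f g : Fin n → ℕ} → (∀ i → f i ℕ.≤ g i) → sum f ℕ.≤ sum g
sum-mono-≤ {zero}  f≤g = z≤n
sum-mono-≤ {suc n} f≤g = ℕ.+-mono-≤ (f≤g zero) (sum-mono-≤ (f≤g ∘ suc))

sum-const : ∀ n x → sum {n} (λ _ → x) ≡ n ℕ.* x
sum-const zero    x = refl
sum-const (suc n) x = cong (x ℕ.+_) (sum-const n x)

sum≡0⇒≡0 : ∀ {n} (f : Fin n → ℕ) → sum f ≡ 0 → ∀ i → f i ≡ 0
sum≡0⇒≡0 f eq zero    = ℕ.m+n≡0⇒m≡0 (f zero) eq
sum≡0⇒≡0 f eq (suc i) = sum≡0⇒≡0 (f ∘ suc) (ℕ.m+n≡0⇒n≡0 (f zero) eq) i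

-- Cost functions with natural values.

record IsPolymatroid {m : ℕ} (F : Subset m → ℕ) : Set where
  field
    normal : F ⊥ ≡ 0
    mono   : ∀ A B → A ⊆ B → F A ℕ.≤ F B
    submod : ∀ A B → F (A ∪ B) ℕ.+ F (A ∩ B) ℕ.≤ F A ℕ.+ F B
open IsPolymatroid

-- Values are constant sequences, so equal naturals give the very same element of `ℝ`, as
-- `result-cong` demands.
polymatroidCost : ∀ {m} {F : Subset m → ℕ} → IsPolymatroid F → CostFunction m
polymatroidCost {F = F} P = record
  { cost       = λ A → fromℚ ⌜ F A ⌝
  ; normalized = fromℚ-mono-≤ (ℚ.≤-reflexive (cong ⌜_⌝ (normal P)))
               , fromℚ-mono-≤ (ℚ.≤-reflexive (cong ⌜_⌝ (sym (normal P))))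
  ; nonneg     = λ A → fromℚ-mono-≤ (⌜⌝-mono-≤ {0} {F A} z≤n)
  ; monotone   = λ A B A⊆B → fromℚ-mono-≤ (⌜⌝-mono-≤ (mono P A B A⊆B))
  ; submodular = λ A B → λ ε 0<ε → 0 , λ _ _ → p≤p+ε ε 0<ε
      (subst₂ ℚ._≤_ (⌜⌝-homo-+ (F (A ∪ B)) (F (A ∩ B))) (⌜⌝-homo-+ (F A) (F B))
        (⌜⌝-mono-≤ (submod P A B)))
  }

bit : Bool → ℕ
bit b = if b then 1 else 0

member : ∀ {m} → Fin m → Subset m → ℕ
member e A = bit (lookup A e)

-- An indicator is even modular. Both costs of the construction arise from indicators by sums and
-- truncations.
member-polymatroid : ∀ {m} (e : Fin m) → IsPolymatroid (member e)
member-polymatroid e = record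
  { normal = cong bit (Vec.lookup-replicate e false)
  ; mono   = λ A B A⊆B → monotone′ A B A⊆B
  ; submod = λ A B → ℕ.≤-reflexive (modular′ A B)
  }
  where
  monotone′ : ∀ A B → A ⊆ B → member e A ℕ.≤ member e B
  monotone′ A B A⊆B with lookup A e in eq
  ... | false = z≤n
  ... | true  = ℕ.≤-reflexive (cong bit (sym (Vec.[]=⇒lookup (A⊆B (Vec.lookup⇒[]= e A eq)))))
  bit-modular : ∀ a b → bit (a ∨ b) ℕ.+ bit (a ∧ b) ≡ bit a ℕ.+ bit b
  bit-modular false b     = ℕ.+-identityʳ (bit b)
  bit-modular true  b     = refl
  modular′ : ∀ A B → member e (A ∪ B) ℕ.+ member e (A ∩ B) ≡ member e A ℕ.+ member e B
  modular′ A B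
    rewrite Vec.lookup-zipWith _∨_ e A B | Vec.lookup-zipWith _∧_ e A B =
    bit-modular (lookup A e) (lookup B e)

+-polymatroid : ∀ {m} {F G : Subset m → ℕ} → IsPolymatroid F → IsPolymatroid G →
  IsPolymatroid (λ A → F A ℕ.+ G A)
+-polymatroid {F = F} {G} P Q = record
  { normal = cong₂ ℕ._+_ (normal P) (normal Q)
  ; mono   = λ A B A⊆B → ℕ.+-mono-≤ (mono P A B A⊆B) (mono Q A B A⊆B)
  ; submod = λ A B → subst₂ ℕ._≤_
      (interchange (F (A ∪ B)) (F (A ∩ B)) (G (A ∪ B)) (G (A ∩ B)))
      (interchange (F A) (F B) (G A) (G B))
      (ℕ.+-mono-≤ (submod P A B) (submod Q A B))
  }
  where
  open ℕ.+-*-Solver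
  interchange : ∀ a b c d → (a ℕ.+ b) ℕ.+ (c ℕ.+ d) ≡ (a ℕ.+ c) ℕ.+ (b ℕ.+ d)
  interchange = solve 4 (λ a b c d → (a :+ b) :+ (c :+ d) := (a :+ c) :+ (b :+ d)) refl

sum-polymatroid : ∀ {m} n {F : Fin n → Subset m → ℕ} → (∀ i → IsPolymatroid (F i)) →
  IsPolymatroid (λ A → sum (λ i → F i A))
sum-polymatroid zero    P = record
  { normal = refl ; mono = λ _ _ _ → z≤n ; submod = λ _ _ → z≤n }
sum-polymatroid (suc n) P = +-polymatroid (P zero) (sum-polymatroid n (P ∘ suc))

-- If F A or F B reaches b, that set pays for the union and, by monotonicity, the other one pays for
-- the intersection. Otherwise truncation leaves the right side alone and can only lower the left.
⊓-polymatroid : ∀ {m} {F : Subset m → ℕ} b → IsPolymatroid F → IsPolymatroid (λ A → F A ⊓ b)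
⊓-polymatroid {F = F} b P = record
  { normal = cong (_⊓ b) (normal P)
  ; mono   = λ A B A⊆B → ℕ.⊓-monoˡ-≤ b (mono P A B A⊆B)
  ; submod = submod′
  }
  where
  submod′ : ∀ A B → F (A ∪ B) ⊓ b ℕ.+ F (A ∩ B) ⊓ b ℕ.≤ F A ⊓ b ℕ.+ F B ⊓ b
  submod′ A B with ℕ.≤-total b (F A) | ℕ.≤-total b (F B)
  ... | inj₁ b≤ | _ = ℕ.+-mono-≤
    (ℕ.≤-trans (ℕ.m⊓n≤n (F (A ∪ B)) b) (ℕ.≤-reflexive (sym (ℕ.m≥n⇒m⊓n≡n b≤))))
    (ℕ.⊓-monoˡ-≤ b (mono P (A ∩ B) B (p∩q⊆q A B)))
  ... | inj₂ _ | inj₁ b≤ = ℕ.≤-trans (ℕ.+-mono-≤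
      (ℕ.≤-trans (ℕ.m⊓n≤n (F (A ∪ B)) b) (ℕ.≤-reflexive (sym (ℕ.m≥n⇒m⊓n≡n b≤))))
      (ℕ.⊓-monoˡ-≤ b (mono P (A ∩ B) A (p∩q⊆p A B))))
    (ℕ.≤-reflexive (ℕ.+-comm (F B ⊓ b) (F A ⊓ b)))
  ... | inj₂ ≤b | inj₂ ≤b′ rewrite ℕ.m≤n⇒m⊓n≡m ≤b | ℕ.m≤n⇒m⊓n≡m ≤b′ =
    ℕ.≤-trans (ℕ.+-mono-≤ (ℕ.m⊓n≤m (F (A ∪ B)) b) (ℕ.m⊓n≤m (F (A ∩ B)) b)) (submod P A B)

-- Transcripts of oracle computations.

module _ {m : ℕ} where
  -- The answer is recorded like a last query, so that agreement on the transcript also settles the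
  -- cost of the answer.
  transcript : (Subset m → ℝ) → OracleComputation m → List (Subset m)
  transcript o (return C)  = C ∷ []
  transcript o (query Q k) = Q ∷ transcript o (k (o Q))

  length-transcript : ∀ o c → length (transcript o c) ≡ suc (queries o c)
  length-transcript o (return C)  = refl
  length-transcript o (query Q k) = cong suc (length-transcript o (k (o Q)))

  result∈transcript : ∀ o c → result o c ∈ transcript o c
  result∈transcript o (return C)  = here refl
  result∈transcript o (query Q k) = there (result∈transcript o (k (o Q)))

  -- Agreement on the queries made under `o` is enough even for adaptive queries: equal replies lead
  -- to the same continuation. The replies must be equal by `_≡_`, as a continuation can inspect the
  -- sequence behind a real.
  result-cong : ∀ o o′ c → (∀ {Q} → Q ∈ transcript o c → o′ Q ≡ o Q) → result o′ c ≡ result o c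
  result-cong o o′ (return C)  agree = refl
  result-cong o o′ (query Q k) agree rewrite agree (here refl) =
    result-cong o o′ (k (o Q)) (agree ∘ there)

-- Averaging over all choices of one edge per path.

-- The expectation over a uniformly random R, multiplied by ℓ ^ k to stay in `ℕ`.
∑ᵛ : ∀ k {ℓ} → (Vec (Fin ℓ) k → ℕ) → ℕ
∑ᵛ zero    F = F []
∑ᵛ (suc k) F = sum (λ x → ∑ᵛ k (λ R → F (x ∷ R)))

∑ᵛ-cong : ∀ k {ℓ} {F G : Vec (Fin ℓ) k → ℕ} → (∀ R → F R ≡ G R) → ∑ᵛ k F ≡ ∑ᵛ k G
∑ᵛ-cong zero    F≗G = F≗G []
∑ᵛ-cong (suc k) F≗G = sum-cong-≗ (λ x → ∑ᵛ-cong k (λ R → F≗G (x ∷ R)))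

∑ᵛ-zero : ∀ k {ℓ} → ∑ᵛ k {ℓ} (λ _ → 0) ≡ 0
∑ᵛ-zero zero        = refl
∑ᵛ-zero (suc k) {ℓ} = trans (sum-cong-≗ {ℓ} (λ _ → ∑ᵛ-zero k)) (trans (sum-const ℓ 0) (ℕ.*-zeroʳ ℓ))

∑ᵛ-distrib-+ : ∀ k {ℓ} (F G : Vec (Fin ℓ) k → ℕ) →
  ∑ᵛ k (λ R → F R ℕ.+ G R) ≡ ∑ᵛ k F ℕ.+ ∑ᵛ k G
∑ᵛ-distrib-+ zero    F G = refl
∑ᵛ-distrib-+ (suc k) F G = trans
  (sum-cong-≗ (λ x → ∑ᵛ-distrib-+ k (λ R → F (x ∷ R)) (λ R → G (x ∷ R))))
  (∑-distrib-+ (λ x → ∑ᵛ k (λ R → F (x ∷ R))) (λ x → ∑ᵛ k (λ R → G (x ∷ R))))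

*-distribˡ-∑ᵛ : ∀ k {ℓ} a (F : Vec (Fin ℓ) k → ℕ) → a ℕ.* ∑ᵛ k F ≡ ∑ᵛ k (λ R → a ℕ.* F R)
*-distribˡ-∑ᵛ zero    a F = refl
*-distribˡ-∑ᵛ (suc k) a F = trans (*-distribˡ-sum a (λ x → ∑ᵛ k (λ R → F (x ∷ R))))
  (sum-cong-≗ (λ x → *-distribˡ-∑ᵛ k a (λ R → F (x ∷ R))))

sum<⇒∃< : ∀ {n} (f : Fin n → ℕ) M → sum f ℕ.< n ℕ.* M → ∃[ x ] f x ℕ.< M
sum<⇒∃< {suc n} f M sum< with f zero ℕ.<? M
... | yes f₀<M = zero , f₀<M
... | no  f₀≮M =
  let x , fx<M = sum<⇒∃< (f ∘ suc) M (ℕ.+-cancelˡ-< M _ _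
                   (ℕ.≤-<-trans (ℕ.+-monoˡ-≤ (sum (f ∘ suc)) (ℕ.≮⇒≥ f₀≮M)) sum<))
  in suc x , fx<M

-- Some value is below the average: the coordinates of R are fixed one by one, keeping the remaining
-- average below M.
∑ᵛ<⇒∃< : ∀ k {ℓ} (F : Vec (Fin ℓ) k → ℕ) M → ∑ᵛ k F ℕ.< ℓ ^ k ℕ.* M → ∃[ R ] F R ℕ.< M
∑ᵛ<⇒∃< zero        F M ∑< = [] , subst (F [] ℕ.<_) (ℕ.*-identityˡ M) ∑<
∑ᵛ<⇒∃< (suc k) {ℓ} F M ∑< =
  let x , <M  = sum<⇒∃< _ (ℓ ^ k ℕ.* M) (subst (∑ᵛ (suc k) F ℕ.<_) (ℕ.*-assoc ℓ (ℓ ^ k) M) ∑<)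
      R , <M′ = ∑ᵛ<⇒∃< k (λ R → F (x ∷ R)) M <M
  in x ∷ R , <M′

-- Exponential moments of the number of hits.

-- An edge set with one row per path, so that inductions can remove a path. `size` stands for |Q|
-- and `hits R` for |Q ∩ R|.
Grid : ℕ → ℕ → Set
Grid k ℓ = Fin k → Fin ℓ → Bool

module _ {k ℓ : ℕ} where
  size : Grid k ℓ → ℕ
  size a = sum (λ i → sum (λ p → bit (a i p)))

  hits : Vec (Fin ℓ) k → Grid k ℓ → ℕ
  hits R a = sum (λ i → bit (a i (lookup R i)))

-- Bernoulli's inequality (1 + c/ℓ) ≤ (1 + 1/ℓ)^c without division.
bernoulli : ∀ ℓ c → (ℓ ℕ.+ c) ℕ.* ℓ ^ c ℕ.≤ ℓ ℕ.* suc ℓ ^ c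
bernoulli ℓ zero    = ℕ.≤-reflexive (cong (ℕ._* 1) (ℕ.+-identityʳ ℓ))
bernoulli ℓ (suc c) = begin
  (ℓ ℕ.+ suc c) ℕ.* (ℓ ℕ.* ℓ ^ c)
    -- The added term completes the product (ℓ + 1)(ℓ + c).
    ≤⟨ ℕ.m≤m+n _ (c ℕ.* ℓ ^ c) ⟩
  (ℓ ℕ.+ suc c) ℕ.* (ℓ ℕ.* ℓ ^ c) ℕ.+ c ℕ.* ℓ ^ c
    ≡⟨ solve 3 (λ ℓ c P → (ℓ :+ (con 1 :+ c)) :* (ℓ :* P) :+ c :* P := (con 1 :+ ℓ) :* ((ℓ :+ c) :* P)) refl ℓ c (ℓ ^ c) ⟩
  suc ℓ ℕ.* ((ℓ ℕ.+ c) ℕ.* ℓ ^ c)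
    ≤⟨ ℕ.*-monoʳ-≤ (suc ℓ) (bernoulli ℓ c) ⟩
  suc ℓ ℕ.* (ℓ ℕ.* suc ℓ ^ c)
    ≡⟨ solve 2 (λ ℓ P → (con 1 :+ ℓ) :* (ℓ :* P) := ℓ :* ((con 1 :+ ℓ) :* P)) refl ℓ (suc ℓ ^ c) ⟩
  ℓ ℕ.* (suc ℓ ℕ.* suc ℓ ^ c) ∎
  where
  open ℕ.≤-Reasoning
  open ℕ.+-*-Solver

sum-2^bit : ∀ {ℓ} (a : Fin ℓ → Bool) → sum (λ x → 2 ^ bit (a x)) ≡ ℓ ℕ.+ sum (λ x → bit (a x))
sum-2^bit {ℓ} a = begin
  sum (λ x → 2 ^ bit (a x))              ≡⟨ sum-cong-≗ (λ x → 2^bit (a x)) ⟩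
  sum (λ x → 1 ℕ.+ bit (a x))            ≡⟨ ∑-distrib-+ (λ _ → 1) (λ x → bit (a x)) ⟩
  sum {ℓ} (λ _ → 1) ℕ.+ sum (bit ∘ a)
    ≡⟨ cong (ℕ._+ sum (bit ∘ a)) (trans (sum-const ℓ 1) (ℕ.*-identityʳ ℓ)) ⟩
  ℓ ℕ.+ sum (bit ∘ a)                    ∎
  where
  open ≡-Reasoning
  2^bit : ∀ b → 2 ^ bit b ≡ 1 ℕ.+ bit b
  2^bit false = refl
  2^bit true  = refl

-- The coordinates of R are independent, so the exponential moment of hits is a product over the rows.
∑ᵛ-2^hits : ∀ k {ℓ} (a : Grid k ℓ) →
  ∑ᵛ k (λ R → 2 ^ hits R a) ℕ.* ℓ ^ size a ℕ.≤ ℓ ^ k ℕ.* suc ℓ ^ size a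
∑ᵛ-2^hits zero        a = ℕ.≤-refl
∑ᵛ-2^hits (suc k) {ℓ} a = begin
  sum (λ x → ∑ᵛ k (λ R → 2 ^ (bit (a zero x) ℕ.+ hits R b))) ℕ.* ℓ ^ (c ℕ.+ d)
    ≡⟨ cong₂ ℕ._*_ factor (ℕ.^-distribˡ-+-* ℓ c d) ⟩
  (ℓ ℕ.+ c) ℕ.* S ℕ.* (ℓ ^ c ℕ.* ℓ ^ d)
    ≡⟨ interchange (ℓ ℕ.+ c) S (ℓ ^ c) (ℓ ^ d) ⟩
  (ℓ ℕ.+ c) ℕ.* ℓ ^ c ℕ.* (S ℕ.* ℓ ^ d)
    ≤⟨ ℕ.*-mono-≤ (bernoulli ℓ c) (∑ᵛ-2^hits k b) ⟩
  ℓ ℕ.* suc ℓ ^ c ℕ.* (ℓ ^ k ℕ.* suc ℓ ^ d)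
    ≡⟨ interchange ℓ (suc ℓ ^ c) (ℓ ^ k) (suc ℓ ^ d) ⟩
  ℓ ℕ.* ℓ ^ k ℕ.* (suc ℓ ^ c ℕ.* suc ℓ ^ d)
    ≡⟨ cong (ℓ ℕ.* ℓ ^ k ℕ.*_) (ℕ.^-distribˡ-+-* (suc ℓ) c d) ⟨
  ℓ ℕ.* ℓ ^ k ℕ.* suc ℓ ^ (c ℕ.+ d) ∎
  where
  open ℕ.≤-Reasoning
  open ℕ.+-*-Solver
  b : Grid k ℓ
  b = a ∘ suc
  c d S : ℕ
  c = sum (λ p → bit (a zero p))
  d = size b
  S = ∑ᵛ k (λ R → 2 ^ hits R b)
  interchange : ∀ w x y z → w ℕ.* x ℕ.* (y ℕ.* z) ≡ w ℕ.* y ℕ.* (x ℕ.* z)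
  interchange = solve 4 (λ w x y z → w :* x :* (y :* z) := w :* y :* (x :* z)) refl
  factor : sum (λ x → ∑ᵛ k (λ R → 2 ^ (bit (a zero x) ℕ.+ hits R b))) ≡ (ℓ ℕ.+ c) ℕ.* S
  factor = trans
    (sum-cong-≗ (λ x → trans
      (∑ᵛ-cong k (λ R → ℕ.^-distribˡ-+-* 2 (bit (a zero x)) (hits R b)))
      (sym (*-distribˡ-∑ᵛ k (2 ^ bit (a zero x)) (λ R → 2 ^ hits R b)))))
    (trans (sym (*-distribʳ-sum S (λ x → 2 ^ bit (a zero x))))
      (cong (ℕ._* S) (sum-2^bit (a zero))))

-- Read as x / y ≤ (1 + 1/ℓ)^c. Raising the exponent weakens the bound, so one M can serve all
-- queried sets.
^-ratio-mono : ∀ x y {ℓ M c} → c ℕ.≤ M →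
  x ℕ.* ℓ ^ c ℕ.≤ y ℕ.* suc ℓ ^ c → x ℕ.* ℓ ^ M ℕ.≤ y ℕ.* suc ℓ ^ M
^-ratio-mono x y {ℓ} {M} {c} c≤M h = begin
  x ℕ.* ℓ ^ M                                ≡⟨ split x ℓ ⟩
  x ℕ.* ℓ ^ c ℕ.* ℓ ^ (M ∸ c)                ≤⟨ ℕ.*-mono-≤ h (ℕ.^-monoˡ-≤ (M ∸ c) (ℕ.n≤1+n ℓ)) ⟩
  y ℕ.* suc ℓ ^ c ℕ.* suc ℓ ^ (M ∸ c)        ≡⟨ split y (suc ℓ) ⟨
  y ℕ.* suc ℓ ^ M                            ∎
  where
  open ℕ.≤-Reasoning
  split : ∀ z b → z ℕ.* b ^ M ≡ z ℕ.* b ^ c ℕ.* b ^ (M ∸ c)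
  split z b = trans
    (cong (z ℕ.*_) (trans (cong (b ^_) (sym (ℕ.m+[n∸m]≡n c≤M))) (ℕ.^-distribˡ-+-* b c (M ∸ c))))
    (sym (ℕ.*-assoc z (b ^ c) (b ^ (M ∸ c))))

module _ {k ℓ : ℕ} .{{_ : ℕ.NonZero ℓ}} where
  -- The hypothesis says (1 + 1/ℓ)^M ≤ X, which makes X a bound on the mean of 2^|Q ∩ R|.
  ∑ᵛ-2^hits-≤ : ∀ M X → suc ℓ ^ M ℕ.≤ ℓ ^ M ℕ.* X →
    (a : Grid k ℓ) → size a ℕ.≤ M → ∑ᵛ k (λ R → 2 ^ hits R a) ℕ.≤ ℓ ^ k ℕ.* X
  ∑ᵛ-2^hits-≤ M X growth a size≤M = ℕ.*-cancelʳ-≤ _ _ (ℓ ^ M) {{ℕ.m^n≢0 ℓ M}} (begin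
    ∑ᵛ k (λ R → 2 ^ hits R a) ℕ.* ℓ ^ M ≤⟨ ^-ratio-mono (∑ᵛ k (λ R → 2 ^ hits R a)) (ℓ ^ k) size≤M (∑ᵛ-2^hits k a) ⟩
    ℓ ^ k ℕ.* suc ℓ ^ M                 ≤⟨ ℕ.*-monoʳ-≤ (ℓ ^ k) growth ⟩
    ℓ ^ k ℕ.* (ℓ ^ M ℕ.* X)
      ≡⟨ solve 3 (λ a b c → a :* (b :* c) := a :* c :* b) refl (ℓ ^ k) (ℓ ^ M) X ⟩
    ℓ ^ k ℕ.* X ℕ.* ℓ ^ M               ∎)
    where
    open ℕ.≤-Reasoning
    open ℕ.+-*-Solver

  -- Markov's inequality and the union bound in one: if the total is below 2 ^ b, so is each
  -- summand, and no set in the list has b hits.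
  potential : List (Grid k ℓ) → Vec (Fin ℓ) k → ℕ
  potential []       R = 0
  potential (a ∷ as) R = 2 ^ hits R a ℕ.+ potential as R

  ∑ᵛ-potential : ∀ M X → suc ℓ ^ M ℕ.≤ ℓ ^ M ℕ.* X →
    ∀ as → All (λ a → size a ℕ.≤ M) as → ∑ᵛ k (potential as) ℕ.≤ ℓ ^ k ℕ.* (length as ℕ.* X)
  ∑ᵛ-potential M X growth []       []               = ℕ.≤-trans (ℕ.≤-reflexive (∑ᵛ-zero k)) z≤n
  ∑ᵛ-potential M X growth (a ∷ as) (a≤M ∷ as≤M) = begin
    ∑ᵛ k (potential (a ∷ as))
      ≡⟨ ∑ᵛ-distrib-+ k (λ R → 2 ^ hits R a) (potential as) ⟩
    ∑ᵛ k (λ R → 2 ^ hits R a) ℕ.+ ∑ᵛ k (potential as)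
      ≤⟨ ℕ.+-mono-≤ (∑ᵛ-2^hits-≤ M X growth a a≤M) (∑ᵛ-potential M X growth as as≤M) ⟩
    ℓ ^ k ℕ.* X ℕ.+ ℓ ^ k ℕ.* (length as ℕ.* X)
      ≡⟨ ℕ.*-distribˡ-+ (ℓ ^ k) X (length as ℕ.* X) ⟨
    ℓ ^ k ℕ.* (X ℕ.+ length as ℕ.* X) ∎
    where open ℕ.≤-Reasoning

  potential<⇒hits< : ∀ R b as → potential as R ℕ.< 2 ^ b → All (λ a → hits R a ℕ.< b) as
  potential<⇒hits< R b []       _ = []
  potential<⇒hits< R b (a ∷ as) h =
    ℕ.≰⇒> (λ b≤ → ℕ.<⇒≱ (ℕ.m+n≤o⇒m≤o (suc (2 ^ hits R a)) h) (ℕ.^-monoʳ-≤ 2 b≤)) ∷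
    potential<⇒hits< R b as (ℕ.≤-<-trans (ℕ.m≤n+m (potential as R) (2 ^ hits R a)) h)

  -- The mean potential is at most `length as` times X, hence below 2 ^ b, and some R lies below 2 ^
  -- b too.
  avoiding-selection : ∀ M X b → suc ℓ ^ M ℕ.≤ ℓ ^ M ℕ.* X →
    (as : List (Grid k ℓ)) → All (λ a → size a ℕ.≤ M) as → length as ℕ.* X ℕ.< 2 ^ b →
    ∃[ R ] All (λ a → hits R a ℕ.< b) as
  avoiding-selection M X b growth as as≤M few =
    let R , R< = ∑ᵛ<⇒∃< k (potential as) (2 ^ b)
                   (ℕ.≤-<-trans (∑ᵛ-potential M X growth as as≤M)
                     (ℕ.*-monoʳ-< (ℓ ^ k) {{ℕ.m^n≢0 ℓ k}} few))
    in R , potential<⇒hits< R b as R<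

-- The network of parallel paths and its cuts.

chain : ∀ {V : Set} {_⟶_ : V → V → Set} n (x : Fin (suc n) → V) →
  (∀ p → x (inject₁ p) ⟶ x (suc p)) → Star _⟶_ (x zero) (x (fromℕ n))
chain zero    x steps = stop
chain (suc n) x steps = steps zero ◅ chain n (x ∘ suc) (steps ∘ suc)

-- k internally disjoint s-t paths with ℓ edges each; the vertices 2 + combine i (fromℕ (suc r)) are isolated.
module ParallelPaths (k r : ℕ) where
  ℓ : ℕ
  ℓ = suc (suc r)

  V : Set
  V = Fin (2 ℕ.+ k ℕ.* ℓ)

  inner : Fin k → {q : Fin ℓ} → View q → V
  inner i ‵fromℕ          = suc zero
  inner i (‵inj₁ {i = q} _) = suc (suc (combine i (inject₁ q)))

  node : Fin k → Fin (suc ℓ) → V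
  node i zero    = zero
  node i (suc q) = inner i (view q)

  node-last : ∀ i → node i (fromℕ ℓ) ≡ suc zero
  node-last i rewrite view-fromℕ (suc r) = refl

  inner≢0 : ∀ i {q} (v : View q) → inner i v ≢ zero
  inner≢0 i ‵fromℕ ()
  inner≢0 i (‵inj₁ _) ()

  inner-injective : ∀ i i′ {q q′} (v : View q) (v′ : View q′) → inner i v ≡ inner i′ v′ →
    q ≡ q′ × (i ≡ i′ ⊎ q ≡ fromℕ (suc r))
  inner-injective i i′ ‵fromℕ ‵fromℕ eq = refl , inj₂ refl
  inner-injective i i′ (‵inj₁ {i = q} _) (‵inj₁ {i = q′} _) eq =
    let i≡i′ , q≡q′ = Fin.combine-injective i (inject₁ q) i′ (inject₁ q′)
                        (Fin.suc-injective (Fin.suc-injective eq))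
    in q≡q′ , inj₁ i≡i′
  inner-injective i i′ ‵fromℕ (‵inj₁ _) ()
  inner-injective i i′ (‵inj₁ _) ‵fromℕ ()

  -- Paths meet only in s and t, and each of these has the same position on every path.
  node-injective : ∀ i i′ q q′ → node i q ≡ node i′ q′ →
    q ≡ q′ × (i ≡ i′ ⊎ q ≡ zero ⊎ q ≡ fromℕ ℓ)
  node-injective i i′ zero    zero     eq = refl , inj₂ (inj₁ refl)
  node-injective i i′ zero    (suc q′) eq = contradiction (sym eq) (inner≢0 i′ (view q′))
  node-injective i i′ (suc q) zero     eq = contradiction eq (inner≢0 i (view q))
  node-injective i i′ (suc q) (suc q′) eq with inner-injective i i′ (view q) (view q′) eq
  ... | q≡q′ , inj₁ i≡i′ = cong suc q≡q′ , inj₁ i≡i′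
  ... | q≡q′ , inj₂ last = cong suc q≡q′ , inj₂ (inj₂ (cong suc last))

  arc : Fin k × Fin ℓ → V × V
  arc (i , p) = node i (inject₁ p) , node i (suc p)

  arc-injective : ∀ x y → arc x ≡ arc y → x ≡ y
  arc-injective (i , p) (i′ , p′) eq
    with node-injective i i′ (inject₁ p) (inject₁ p′) (cong proj₁ eq)
       | node-injective i i′ (suc p) (suc p′) (cong proj₂ eq)
  ... | _ , inj₁ i≡i′        | refl , _           = cong (_, p) i≡i′
  ... | _ , inj₂ _           | refl , inj₁ i≡i′   = cong (_, p) i≡i′
  ... | _ , inj₂ (inj₂ last) | _    , inj₂ _      = contradiction (sym last) Fin.fromℕ≢inject₁
  -- An edge shared by two paths would run from s straight to t, which ℓ ≥ 2 excludes.
  ... | _ , inj₂ (inj₁ p≡0)  | _    , inj₂ (inj₂ sp≡ℓ)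
    with Fin.inject₁-injective {i = p} {zero} p≡0
  ... | refl with Fin.suc-injective sp≡ℓ
  ... | ()

  network : Network
  network = record
    { ∣V∣      = 2 ℕ.+ k ℕ.* ℓ
    ; ∣E∣      = k ℕ.* ℓ
    ; edge     = λ e → arc (remQuot {k} ℓ e)
    ; edge-inj = λ {e} {e′} eq → begin
        e                                ≡⟨ Fin.combine-remQuot {k} ℓ e ⟨
        uncurry combine (remQuot {k} ℓ e)
          ≡⟨ cong (uncurry combine) (arc-injective (remQuot {k} ℓ e) (remQuot {k} ℓ e′) eq) ⟩
        uncurry combine (remQuot {k} ℓ e′) ≡⟨ Fin.combine-remQuot {k} ℓ e′ ⟩
        e′                               ∎
    ; s        = zero
    ; t        = suc zero
    ; s≢t      = λ ()
    }
    where open ≡-Reasoning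

  grid : Subset (k ℕ.* ℓ) → Grid k ℓ
  grid A i p = lookup A (combine i p)

  -- A missed path would still lead from s to t.
  cut-hits-path : ∀ C → IsCut network C → ∀ i → 1 ℕ.≤ sum (λ p → bit (grid C i p))
  cut-hits-path C cut i = ℕ.n≢0⇒n>0 λ missed → cut
    (subst (Star _ zero) (node-last i) (chain ℓ (node i) λ p →
      combine i p ,
      (λ e∈C → contradiction
        (trans (sym (cong bit (Vec.[]=⇒lookup e∈C))) (sum≡0⇒≡0 (λ p → bit (grid C i p)) missed p)) λ ()) ,
      cong arc (Fin.remQuot-combine i p)))

  cut-size : ∀ C → IsCut network C → k ℕ.≤ size (grid C)
  cut-size C cut = ℕ.≤-trans (ℕ.≤-reflexive (sym (trans (sum-const k 1) (ℕ.*-identityʳ k))))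
    (sum-mono-≤ (cut-hits-path C cut))

  module Hidden (R : Vec (Fin ℓ) k) where
    selection : Subset (k ℕ.* ℓ)
    selection = tabulate (λ e → let i , p = remQuot {k} ℓ e in does (p Fin.≟ lookup R i))

    grid-selection : ∀ i p → grid selection i p ≡ does (p Fin.≟ lookup R i)
    grid-selection i p = trans (Vec.lookup∘tabulate _ (combine i p))
      (cong (λ (i , p) → does (p Fin.≟ lookup R i)) (Fin.remQuot-combine i p))

    -- Invariant of reachability without R: wherever v occurs on a path, it comes no later than the
    -- tail of the removed edge. All occurrences count, since s and t lie on every path.
    Before : V → Set
    Before v = ∀ i q → v ≡ node i q → toℕ q ℕ.≤ toℕ (lookup R i)

    before-step : ∀ {u v} → StepAvoiding network selection u v → Before u → Before v
    before-step (e , e∉ , refl) before i′ q eq = goal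
      where
      i : Fin k
      i = proj₁ (remQuot {k} ℓ e)
      p : Fin ℓ
      p = proj₂ (remQuot {k} ℓ e)
      p≢R : p ≢ lookup R i
      p≢R p≡R = e∉ (Vec.lookup⇒[]= e selection
        (trans (Vec.lookup∘tabulate _ e) (dec-true (p Fin.≟ lookup R i) p≡R)))
      p<R : toℕ p ℕ.< toℕ (lookup R i)
      p<R = Fin.≤∧≢⇒<
        (ℕ.≤-trans (ℕ.≤-reflexive (sym (Fin.toℕ-inject₁ p))) (before i (inject₁ p) refl)) p≢R
      goal : toℕ q ℕ.≤ toℕ (lookup R i′)
      goal with node-injective i i′ (suc p) q eq
      ... | refl , inj₁ refl        = p<R
      -- The edge ends in t, at position ℓ, but positions in R are below ℓ.
      ... | refl , inj₂ (inj₂ last) = contradiction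
        (ℕ.≤-trans (ℕ.≤-reflexive (trans (sym (Fin.toℕ-fromℕ ℓ)) (cong toℕ (sym last)))) p<R)
        (ℕ.<⇒≱ (Fin.toℕ<n (lookup R i)))

    before-star : ∀ {u v} → Star (StepAvoiding network selection) u v → Before u → Before v
    before-star stop       before = before
    before-star (x ◅ path) before = before-star path (before-step x before)

    -- The argument supplies a path on which t has position ℓ, contrary to `Before`.
    selection-cut : Fin k → IsCut network selection
    selection-cut i path = ℕ.<⇒≱ (Fin.toℕ<n (lookup R i)) (ℕ.≤-trans
      (ℕ.≤-reflexive (sym (Fin.toℕ-fromℕ ℓ)))
      (before-star path before-s i (fromℕ ℓ) (sym (node-last i))))
      where
      before-s : Before zero
      before-s i zero    _  = z≤n
      before-s i (suc q) eq = contradiction (sym eq) (inner≢0 i (view q))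

    -- The number of edges of A outside R. Enumerating the other positions by `punchIn` presents it
    -- as a sum of indicators.
    rest : Subset (k ℕ.* ℓ) → ℕ
    rest A = sum (λ i → sum (λ p → member (combine i (punchIn (lookup R i) p)) A))

    size≡hits+rest : ∀ A → size (grid A) ≡ hits R (grid A) ℕ.+ rest A
    size≡hits+rest A = trans
      (sum-cong-≗ (λ i → sum-remove {i = lookup R i} (λ p → bit (grid A i p))))
      (∑-distrib-+ (λ i → bit (grid A i (lookup R i))) _)

    hits≤k : ∀ A → hits R (grid A) ℕ.≤ k
    hits≤k A = ℕ.≤-trans (sum-mono-≤ (λ i → bit≤1 (grid A i (lookup R i))))
      (ℕ.≤-reflexive (trans (sum-const k 1) (ℕ.*-identityʳ k)))
      where
      bit≤1 : ∀ b → bit b ℕ.≤ 1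
      bit≤1 false = z≤n
      bit≤1 true  = ℕ.≤-refl

    rest-selection : rest selection ≡ 0
    rest-selection = trans (sum-cong-≗ (λ i → trans (sum-cong-≗ (λ p → cong bit
        (trans (grid-selection i (punchIn (lookup R i) p))
          (dec-false (_ Fin.≟ _) (Fin.punchInᵢ≢i (lookup R i) p)))))
        (trans (sum-const (suc r) 0) (ℕ.*-zeroʳ (suc r)))))
      (trans (sum-const k 0) (ℕ.*-zeroʳ k))

  -- The visible and the hidden cost.

  visible : Subset (k ℕ.* ℓ) → ℕ
  visible A = size (grid A) ⊓ k

  visible-polymatroid : IsPolymatroid visible
  visible-polymatroid = ⊓-polymatroid k
    (sum-polymatroid k λ i → sum-polymatroid ℓ λ p → member-polymatroid (combine i p))

  module _ (R : Vec (Fin ℓ) k) (β : ℕ) where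
    open Hidden R

    hidden : Subset (k ℕ.* ℓ) → ℕ
    hidden A = (rest A ℕ.+ hits R (grid A) ⊓ β) ⊓ k

    hidden-polymatroid : IsPolymatroid hidden
    hidden-polymatroid = ⊓-polymatroid k (+-polymatroid
      (sum-polymatroid k λ i → sum-polymatroid (suc r) λ p →
        member-polymatroid (combine i (punchIn (lookup R i) p)))
      (⊓-polymatroid β (sum-polymatroid k λ i → member-polymatroid (combine i (lookup R i)))))

    -- For small A the truncation at β is idle. A larger A has more than 2k edges, of which at most
    -- k are in R, so both costs saturate at k.
    hidden≡visible : ∀ A → (size (grid A) ℕ.≤ k ℕ.+ k → hits R (grid A) ℕ.≤ β) →
      hidden A ≡ visible A
    hidden≡visible A few with size (grid A) ℕ.≤? k ℕ.+ k
    ... | yes small = cong (_⊓ k) (begin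
      rest A ℕ.+ hits R (grid A) ⊓ β ≡⟨ cong (rest A ℕ.+_) (ℕ.m≤n⇒m⊓n≡m (few small)) ⟩
      rest A ℕ.+ hits R (grid A)     ≡⟨ ℕ.+-comm (rest A) _ ⟩
      hits R (grid A) ℕ.+ rest A     ≡⟨ size≡hits+rest A ⟨
      size (grid A)                  ∎)
      where open ≡-Reasoning
    ... | no large = trans (ℕ.m≥n⇒m⊓n≡n (ℕ.m≤n⇒m≤n+o _ k≤rest))
                       (sym (ℕ.m≥n⇒m⊓n≡n (ℕ.≤-trans (ℕ.m≤m+n k k) 2k≤size)))
      where
      2k≤size : k ℕ.+ k ℕ.≤ size (grid A)
      2k≤size = ℕ.<⇒≤ (ℕ.≰⇒> large)
      k≤rest : k ℕ.≤ rest A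
      k≤rest = ℕ.+-cancelˡ-≤ k _ _ (ℕ.≤-trans 2k≤size
        (ℕ.≤-trans (ℕ.≤-reflexive (size≡hits+rest A)) (ℕ.+-monoˡ-≤ (rest A) (hits≤k A))))

    hidden-selection≤ : hidden selection ℕ.≤ β ⊓ k
    hidden-selection≤ rewrite rest-selection = ℕ.⊓-monoˡ-≤ k (ℕ.m⊓n≤n _ β)

    -- The approximation guarantee compares with exact minimum cuts, so R must be optimal and not
    -- merely cheap. Either the truncation at β is idle and |C| ≥ k decides, or the hits alone
    -- contribute β.
    hidden-cut≥ : ∀ C → IsCut network C → β ⊓ k ℕ.≤ hidden C
    hidden-cut≥ C cut = ℕ.⊓-glb (β⊓k≤ (ℕ.≤-total (hits R (grid C)) β)) (ℕ.m⊓n≤n β k)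
      where
      β⊓k≤ : hits R (grid C) ℕ.≤ β ⊎ β ℕ.≤ hits R (grid C) →
        β ⊓ k ℕ.≤ rest C ℕ.+ hits R (grid C) ⊓ β
      β⊓k≤ (inj₁ h≤β) rewrite ℕ.m≤n⇒m⊓n≡m h≤β | ℕ.+-comm (rest C) (hits R (grid C)) =
        ℕ.≤-trans (ℕ.m⊓n≤n β k)
          (ℕ.≤-trans (cut-size C cut) (ℕ.≤-reflexive (size≡hits+rest C)))
      β⊓k≤ (inj₂ β≤h) rewrite ℕ.m≥n⇒m⊓n≡n β≤h =
        ℕ.≤-trans (ℕ.m⊓n≤m β k) (ℕ.m≤n+m β (rest C))

    selection-minCut : Fin k → IsMinCut network (polymatroidCost hidden-polymatroid) selection
    selection-minCut i = selection-cut i , λ D cut →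
      fromℚ-mono-≤ (⌜⌝-mono-≤ (ℕ.≤-trans hidden-selection≤ (hidden-cut≥ D cut)))

    visible-cut : ∀ C → IsCut network C → visible C ≡ k
    visible-cut C cut = ℕ.m≥n⇒m⊓n≡n (cut-size C cut)

-- Upper bounds on powers of 1 + 1/ℓ.

-- Bernoulli's inequality (1 - 1/(n+1))^h ≥ 1 - h/(n+1), where x ≤ n + 1 - h.
suc^-≤ : ∀ n h x → x ℕ.+ h ℕ.≤ suc n → suc n ^ h ℕ.* x ℕ.≤ n ^ h ℕ.* suc n
suc^-≤ n zero    x x≤ = ℕ.*-monoʳ-≤ 1 (subst (ℕ._≤ suc n) (ℕ.+-identityʳ x) x≤)
suc^-≤ n (suc h) x x≤ = begin
  suc n ℕ.* P ℕ.* x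
    ≡⟨ solve 3 (λ n P x → (con 1 :+ n) :* P :* x := P :* x :+ n :* (P :* x)) refl n P x ⟩
  P ℕ.* x ℕ.+ n ℕ.* (P ℕ.* x) ≤⟨ ℕ.+-monoˡ-≤ (n ℕ.* (P ℕ.* x)) (ℕ.*-monoʳ-≤ P x≤n) ⟩
  P ℕ.* n ℕ.+ n ℕ.* (P ℕ.* x)
    ≡⟨ solve 3 (λ n P x → P :* n :+ n :* (P :* x) := n :* (P :* (con 1 :+ x))) refl n P x ⟩
  n ℕ.* (P ℕ.* suc x)         ≤⟨ ℕ.*-monoʳ-≤ n (suc^-≤ n h (suc x) (subst (ℕ._≤ suc n) (ℕ.+-suc x h) x≤)) ⟩
  n ℕ.* (n ^ h ℕ.* suc n)     ≡⟨ ℕ.*-assoc n (n ^ h) (suc n) ⟨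
  n ℕ.* n ^ h ℕ.* suc n       ∎
  where
  open ℕ.≤-Reasoning
  open ℕ.+-*-Solver
  P : ℕ
  P = suc n ^ h
  x≤n : x ℕ.≤ n
  x≤n = ℕ.m+n≤o⇒m≤o x (ℕ.s≤s⁻¹ (subst (ℕ._≤ suc n) (ℕ.+-suc x h) x≤))

-- With x = h + 1, the previous inequality gives (1 + 1/(2h))^h ≤ (2h + 1)/(h + 1) ≤ 2.
suc[2h]^h≤ : ∀ h → suc (2 ℕ.* h) ^ h ℕ.≤ (2 ℕ.* h) ^ h ℕ.* 2
suc[2h]^h≤ h = ℕ.*-cancelʳ-≤ _ _ (suc h) (begin
  suc n ^ h ℕ.* suc h     ≤⟨ suc^-≤ n h (suc h) (ℕ.≤-reflexive (cong (λ x → suc (h ℕ.+ x)) (sym (ℕ.+-identityʳ h)))) ⟩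
  n ^ h ℕ.* suc n         ≤⟨ ℕ.*-monoʳ-≤ (n ^ h) (ℕ.n≤1+n (suc n)) ⟩
  n ^ h ℕ.* suc (suc n)
    ≡⟨ solve 2 (λ h P → P :* (con 2 :+ con 2 :* h) := P :* con 2 :* (con 1 :+ h)) refl h (n ^ h) ⟩
  n ^ h ℕ.* 2 ℕ.* suc h   ∎)
  where
  open ℕ.≤-Reasoning
  open ℕ.+-*-Solver
  n : ℕ
  n = 2 ℕ.* h

^-distribʳ-* : ∀ x y n → (x ℕ.* y) ^ n ≡ x ^ n ℕ.* y ^ n
^-distribʳ-* x y zero    = refl
^-distribʳ-* x y (suc n) = trans (cong (x ℕ.* y ℕ.*_) (^-distribʳ-* x y n))
  (solve 4 (λ x y a b → x :* y :* (a :* b) := x :* a :* (y :* b)) refl x y (x ^ n) (y ^ n))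
  where open ℕ.+-*-Solver

-- Since 2k = h · 4j, this is the (4j)-th power of (1 + 1/ℓ)^h ≤ 2.
growth : ∀ h j → let ℓ = 2 ℕ.* h; k = ℓ ℕ.* j in
  suc ℓ ^ (k ℕ.+ k) ℕ.≤ ℓ ^ (k ℕ.+ k) ℕ.* 2 ^ (4 ℕ.* j)
growth h j = subst (λ e → suc ℓ ^ e ℕ.≤ ℓ ^ e ℕ.* 2 ^ (4 ℕ.* j))
  (solve 2 (λ h j → h :* (con 4 :* j) := con 2 :* h :* j :+ con 2 :* h :* j) refl h j) (begin
  suc ℓ ^ (h ℕ.* (4 ℕ.* j))                     ≡⟨ ℕ.^-*-assoc (suc ℓ) h (4 ℕ.* j) ⟨
  (suc ℓ ^ h) ^ (4 ℕ.* j)                       ≤⟨ ℕ.^-monoˡ-≤ (4 ℕ.* j) (suc[2h]^h≤ h) ⟩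
  (ℓ ^ h ℕ.* 2) ^ (4 ℕ.* j)                     ≡⟨ ^-distribʳ-* (ℓ ^ h) 2 (4 ℕ.* j) ⟩
  (ℓ ^ h) ^ (4 ℕ.* j) ℕ.* 2 ^ (4 ℕ.* j)         ≡⟨ cong (ℕ._* 2 ^ (4 ℕ.* j)) (ℕ.^-*-assoc ℓ h (4 ℕ.* j)) ⟩
  ℓ ^ (h ℕ.* (4 ℕ.* j)) ℕ.* 2 ^ (4 ℕ.* j)       ∎)
  where
  open ℕ.≤-Reasoning
  open ℕ.+-*-Solver
  ℓ : ℕ
  ℓ = 2 ℕ.* h

n<2^n : ∀ n → n ℕ.< 2 ^ n
n<2^n zero    = s≤s z≤n
n<2^n (suc n) = subst (suc (suc n) ℕ.≤_) (cong (2 ^ n ℕ.+_) (sym (ℕ.+-identityʳ (2 ^ n))))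
  (ℕ.+-mono-≤ (ℕ.m^n>0 2 n) (n<2^n n))

-- Fooling the algorithm.

module _ (k r : ℕ) where
  open ParallelPaths k r

  visibleCost : CostFunction (k ℕ.* ℓ)
  visibleCost = polymatroidCost visible-polymatroid

  hiddenCost : Vec (Fin ℓ) k → ℕ → CostFunction (k ℕ.* ℓ)
  hiddenCost R β = polymatroidCost (hidden-polymatroid R β)

  -- No reply tells the two costs apart, so both runs return the same C. As C is in the transcript,
  -- its hidden cost is its visible cost, which is k for every cut.
  fooled : ∀ R β (c : OracleComputation (k ℕ.* ℓ)) →
    (∀ {Q} → Q ∈ transcript (cost visibleCost) c →
      size (grid Q) ℕ.≤ k ℕ.+ k → hits R (grid Q) ℕ.≤ β) →
    let C = result (cost (hiddenCost R β)) c in IsCut network C → hidden R β C ≡ k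
  fooled R β c few = subst (λ C → IsCut network C → hidden R β C ≡ k)
    (sym (result-cong (cost visibleCost) (cost (hiddenCost R β)) c
      (λ {Q} Q∈ → cong (λ x → fromℚ ⌜ x ⌝) (agree Q Q∈))))
    (λ cut → trans (agree C (result∈transcript (cost visibleCost) c)) (visible-cut R β C cut))
    where
    C : Subset (k ℕ.* ℓ)
    C = result (cost visibleCost) c
    agree : ∀ Q → Q ∈ transcript (cost visibleCost) c → hidden R β Q ≡ visible Q
    agree Q Q∈ = hidden≡visible R β Q (few Q∈)

  -- Queries with more than 2k edges cannot reveal R and are filtered out before averaging. The
  -- exponent is `suc β` because fewer than `suc β` hits means at most β.
  hiding-place : ∀ β X → suc ℓ ^ (k ℕ.+ k) ℕ.≤ ℓ ^ (k ℕ.+ k) ℕ.* X →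
    (Qs : List (Subset (k ℕ.* ℓ))) → length Qs ℕ.* X ℕ.< 2 ^ suc β →
    ∃[ R ] (∀ {Q} → Q ∈ Qs → size (grid Q) ℕ.≤ k ℕ.+ k → hits R (grid Q) ℕ.≤ β)
  hiding-place β X growth Qs few =
    let R , missed = avoiding-selection (k ℕ.+ k) X (suc β) growth (filter small? grids)
          (all-filter small? grids) (ℕ.≤-<-trans (ℕ.*-monoˡ-≤ X |grids|) few)
    in R , λ Q∈ small →
      ℕ.s≤s⁻¹ (All.lookup missed (∈-filter⁺ small? (∈-map⁺ grid Q∈) small))
    where
    small? : ∀ a → Dec (size a ℕ.≤ k ℕ.+ k)
    small? a = size a ℕ.≤? k ℕ.+ k
    grids : List (Grid k ℓ)
    grids = map grid Qs
    |grids| : length (filter small? grids) ℕ.≤ length Qs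
    |grids| = ℕ.≤-trans (length-filter small? grids) (ℕ.≤-reflexive (length-map grid Qs))

-- From the real approximation guarantee to an inequality in `ℕ`.

-- Both real inequalities are read at one late index with slack ε, giving k ≤ (ε u + ε) b + ε.
-- Multiplication by e = 1/ε clears the fractions.
ratio-bound : ∀ {a : ℝ} {k b e u n q} ε → 0ℚ ℚ.< ε → ⌜ e ⌝ ℚ.* ε ≡ 1ℚ →
  n ℕ.≤ u ℕ.* u ℕ.* q → ∣ a ∣ ≤ fromℚ ε * √[ n / q ] → fromℚ ⌜ k ⌝ ≤ a * fromℚ ⌜ b ⌝ →
  e ℕ.* k ℕ.≤ suc (suc u ℕ.* b)
ratio-bound {a} {k} {b} {e} {u} {n} {q} ε 0<ε eε≡1 n≤ a≤ k≤ =
  ⌜⌝-cancel-≤ (begin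
    ⌜ e ℕ.* k ⌝                                   ≡⟨ ⌜⌝-homo-* e k ⟩
    ⌜ e ⌝ ℚ.* ⌜ k ⌝                               ≤⟨ ℚ.*-monoˡ-≤-nonNeg ⌜ e ⌝ {{nonNeg e}} k≤′ ⟩
    ⌜ e ⌝ ℚ.* ((ε ℚ.* ⌜ u ⌝ ℚ.+ ε) ℚ.* ⌜ b ⌝ ℚ.+ ε)
      ≡⟨ solve 4 (λ e ε u b → e :* ((ε :* u :+ ε) :* b :+ ε) := (e :* ε) :+ ((e :* ε) :+ (e :* ε) :* u) :* b) refl ⌜ e ⌝ ε ⌜ u ⌝ ⌜ b ⌝ ⟩
    (⌜ e ⌝ ℚ.* ε) ℚ.+ ((⌜ e ⌝ ℚ.* ε) ℚ.+ (⌜ e ⌝ ℚ.* ε) ℚ.* ⌜ u ⌝) ℚ.* ⌜ b ⌝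
      ≡⟨ cong (λ x → x ℚ.+ (x ℚ.+ x ℚ.* ⌜ u ⌝) ℚ.* ⌜ b ⌝) eε≡1 ⟩
    1ℚ ℚ.+ (1ℚ ℚ.+ 1ℚ ℚ.* ⌜ u ⌝) ℚ.* ⌜ b ⌝
      ≡⟨ cong (λ x → 1ℚ ℚ.+ (1ℚ ℚ.+ x) ℚ.* ⌜ b ⌝) (ℚ.*-identityˡ ⌜ u ⌝) ⟩
    1ℚ ℚ.+ (⌜ 1 ⌝ ℚ.+ ⌜ u ⌝) ℚ.* ⌜ b ⌝            ≡⟨ cong (λ x → 1ℚ ℚ.+ x ℚ.* ⌜ b ⌝) (⌜⌝-homo-+ 1 u) ⟨
    1ℚ ℚ.+ ⌜ suc u ⌝ ℚ.* ⌜ b ⌝                    ≡⟨ cong (1ℚ ℚ.+_) (⌜⌝-homo-* (suc u) b) ⟨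
    ⌜ 1 ⌝ ℚ.+ ⌜ suc u ℕ.* b ⌝                     ≡⟨ ⌜⌝-homo-+ 1 (suc u ℕ.* b) ⟨
    ⌜ suc (suc u ℕ.* b) ⌝                         ∎)
  where
  open ℚ.≤-Reasoning
  open ℚ.+-*-Solver
  nonNeg : ∀ n → ℚ.NonNegative ⌜ n ⌝
  nonNeg n = ℚ.nonNegative (⌜⌝-mono-≤ {0} {n} z≤n)
  k≤′ : ⌜ k ⌝ ℚ.≤ (ε ℚ.* ⌜ u ⌝ ℚ.+ ε) ℚ.* ⌜ b ⌝ ℚ.+ ε
  k≤′ with a≤ ε 0<ε | k≤ ε 0<ε
  ... | M , a≤ᵢ | N , k≤ᵢ = begin
    ⌜ k ⌝                                           ≤⟨ k≤ᵢ i (ℕ.m≤n⊔m M N) ⟩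
    seq a i ℚ.* ⌜ b ⌝ ℚ.+ ε                         ≤⟨ weaken (p≤∣p∣ (seq a i)) ⟩
    ℚ.∣ seq a i ∣ ℚ.* ⌜ b ⌝ ℚ.+ ε                   ≤⟨ weaken (a≤ᵢ i (ℕ.m≤m⊔n M N)) ⟩
    (ε ℚ.* seq √[ n / q ] i ℚ.+ ε) ℚ.* ⌜ b ⌝ ℚ.+ ε
      ≤⟨ weaken (ℚ.+-monoˡ-≤ ε (ℚ.*-monoˡ-≤-nonNeg ε {{ℚ.nonNegative (ℚ.<⇒≤ 0<ε)}} (√-seq-≤ {n} {q} u n≤ i))) ⟩
    (ε ℚ.* ⌜ u ⌝ ℚ.+ ε) ℚ.* ⌜ b ⌝ ℚ.+ ε             ∎
    where
    i : ℕ
    i = M ℕ.⊔ N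
    weaken : ∀ {x y} → x ℚ.≤ y → x ℚ.* ⌜ b ⌝ ℚ.+ ε ℚ.≤ y ℚ.* ⌜ b ⌝ ℚ.+ ε
    weaken x≤y = ℚ.+-monoˡ-≤ ε (ℚ.*-monoʳ-≤-nonNeg ⌜ b ⌝ {{nonNeg b}} x≤y)
    p≤∣p∣ : ∀ p → p ℚ.≤ ℚ.∣ p ∣
    p≤∣p∣ p with ℚ.≤-total 0ℚ p
    ... | inj₁ 0≤p = ℚ.≤-reflexive (sym (ℚ.0≤p⇒∣p∣≡p 0≤p))
    ... | inj₂ p≤0 = ℚ.≤-trans p≤0 (ℚ.0≤∣p∣ p)

-- Choice of parameters.

-- Powers of u = 2 ^ j used in `few-queries`: c absorbs the coefficient through c < 2 ^ c ≤ u ^ c, 5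
-- d the d-th power of an input size up to u ^ 5, and 4 the moment bound 2 ^ (4 j).
exponent : ℕ → ℕ → ℕ
exponent c d = c ℕ.+ (5 ℕ.* d ℕ.+ 4)

exponent>0 : ∀ c d → 0 ℕ.< exponent c d
exponent>0 c d = ℕ.≤-trans (s≤s z≤n)
  (ℕ.≤-trans (ℕ.m≤n+m 4 (5 ℕ.* d)) (ℕ.m≤n+m (5 ℕ.* d ℕ.+ 4) c))

-- There are ℓ j paths of ℓ = 2^j edges and a hidden cut of cost at most β = O(j), so that the
-- ratio ℓ j / β has order 2^j, and 2^j ≥ √(n / log n).
module Parameters (c d N r : ℕ) (ℓ≡ : suc (suc r) ≡ 2 ^ suc N) where
  j u ℓ k n D β : ℕ
  -- Large enough for n ≥ N, where the o-bound applies, and positive.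
  j = suc N
  u = 2 ^ j
  ℓ = suc (suc r)
  k = ℓ ℕ.* j
  n = 2 ℕ.+ k ℕ.* ℓ
  D = exponent c d
  β = j ℕ.* D

  open ℕ.≤-Reasoning
  open ℕ.+-*-Solver

  1≤kℓ : 1 ℕ.≤ k ℕ.* ℓ
  1≤kℓ = s≤s z≤n

  ℓℓ≤kℓ : ℓ ℕ.* ℓ ℕ.≤ k ℕ.* ℓ
  ℓℓ≤kℓ = ℕ.*-monoˡ-≤ ℓ (ℕ.m≤m*n ℓ j)

  N≤n : N ℕ.≤ n
  N≤n = begin
    N          ≤⟨ ℕ.n≤1+n N ⟩
    j          ≤⟨ ℕ.m≤n*m j ℓ ⟩
    k          ≤⟨ ℕ.m≤m*n k ℓ ⟩
    k ℕ.* ℓ    ≤⟨ ℕ.m≤n+m _ 2 ⟩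
    n          ∎

  j+j≤log : j ℕ.+ j ℕ.≤ ⌊log₂ n ⌋
  j+j≤log = begin
    j ℕ.+ j                  ≡⟨ ⌊log₂[2^n]⌋≡n (j ℕ.+ j) ⟨
    ⌊log₂ 2 ^ (j ℕ.+ j) ⌋    ≤⟨ ⌊log₂⌋-mono-≤ (begin
      2 ^ (j ℕ.+ j)   ≡⟨ ℕ.^-distribˡ-+-* 2 j j ⟩
      u ℕ.* u         ≡⟨ cong₂ ℕ._*_ ℓ≡ ℓ≡ ⟨
      ℓ ℕ.* ℓ         ≤⟨ ℓℓ≤kℓ ⟩
      k ℕ.* ℓ         ≤⟨ ℕ.m≤n+m _ 2 ⟩
      n               ∎) ⟩
    ⌊log₂ n ⌋                ∎

  -- Here n = 2 + ℓ² j ≤ ℓ² · 2j, and log n ≥ 2j because n ≥ ℓ² = 2 ^ (2j). Thus √(n / log n) ≤ u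
  -- with no extra constant.
  n≤uulog : n ℕ.≤ u ℕ.* u ℕ.* ⌊log₂ n ⌋
  n≤uulog = begin
    2 ℕ.+ k ℕ.* ℓ                 ≤⟨ ℕ.+-monoˡ-≤ (k ℕ.* ℓ) 2≤kℓ ⟩
    k ℕ.* ℓ ℕ.+ k ℕ.* ℓ
      ≡⟨ solve 2 (λ ℓ j → ℓ :* j :* ℓ :+ ℓ :* j :* ℓ := ℓ :* ℓ :* (j :+ j)) refl ℓ j ⟩
    ℓ ℕ.* ℓ ℕ.* (j ℕ.+ j)         ≤⟨ ℕ.*-monoʳ-≤ (ℓ ℕ.* ℓ) j+j≤log ⟩
    ℓ ℕ.* ℓ ℕ.* ⌊log₂ n ⌋         ≡⟨ cong (λ x → x ℕ.* x ℕ.* ⌊log₂ n ⌋) ℓ≡ ⟩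
    u ℕ.* u ℕ.* ⌊log₂ n ⌋         ∎
    where
    2≤kℓ : 2 ℕ.≤ k ℕ.* ℓ
    2≤kℓ = ℕ.≤-trans (s≤s (s≤s z≤n)) (ℕ.≤-trans (ℕ.m≤m*n ℓ ℓ) ℓℓ≤kℓ)

  growth′ : suc ℓ ^ (k ℕ.+ k) ℕ.≤ ℓ ^ (k ℕ.+ k) ℕ.* 2 ^ (4 ℕ.* j)
  growth′ = subst (λ x → suc x ^ (x ℕ.* j ℕ.+ x ℕ.* j) ℕ.≤ x ^ (x ℕ.* j ℕ.+ x ℕ.* j) ℕ.* 2 ^ (4 ℕ.* j))
    (sym ℓ≡) (growth (2 ^ N) j)

  -- The sum is at most 4 ℓ² j, where 4 ≤ ℓ² and j ≤ ℓ.
  input-size : n ℕ.+ k ℕ.* ℓ ℕ.≤ u ^ 5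
  input-size = begin
    2 ℕ.+ k ℕ.* ℓ ℕ.+ k ℕ.* ℓ
      ≤⟨ ℕ.+-monoˡ-≤ (k ℕ.* ℓ) (ℕ.+-monoˡ-≤ (k ℕ.* ℓ) (ℕ.*-monoʳ-≤ 2 1≤kℓ)) ⟩
    2 ℕ.* (k ℕ.* ℓ) ℕ.+ k ℕ.* ℓ ℕ.+ k ℕ.* ℓ
      ≡⟨ solve 2 (λ ℓ j → con 2 :* (ℓ :* j :* ℓ) :+ ℓ :* j :* ℓ :+ ℓ :* j :* ℓ := con 2 :* con 2 :* (ℓ :* j :* ℓ)) refl ℓ j ⟩
    2 ℕ.* 2 ℕ.* (ℓ ℕ.* j ℕ.* ℓ)
      ≤⟨ ℕ.*-mono-≤ (ℕ.*-mono-≤ 2≤ℓ 2≤ℓ) (ℕ.*-monoˡ-≤ ℓ (ℕ.*-monoʳ-≤ ℓ j≤ℓ)) ⟩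
    ℓ ℕ.* ℓ ℕ.* (ℓ ℕ.* ℓ ℕ.* ℓ)
      ≡⟨ solve 1 (λ ℓ → ℓ :* ℓ :* (ℓ :* ℓ :* ℓ) := ℓ :^ 5) refl ℓ ⟩
    ℓ ^ 5
      ≡⟨ cong (_^ 5) ℓ≡ ⟩
    u ^ 5 ∎
    where
    2≤ℓ : 2 ℕ.≤ ℓ
    2≤ℓ = s≤s (s≤s z≤n)
    j≤ℓ : j ℕ.≤ ℓ
    j≤ℓ = subst (j ℕ.≤_) (sym ℓ≡) (ℕ.<⇒≤ (n<2^n j))

  few-queries : ∀ q → q ℕ.≤ c ℕ.* (n ℕ.+ k ℕ.* ℓ) ^ d → suc q ℕ.* 2 ^ (4 ℕ.* j) ℕ.< 2 ^ suc β
  few-queries q q≤ = begin-strict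
    suc q ℕ.* 2 ^ (4 ℕ.* j)
      ≤⟨ ℕ.*-monoˡ-≤ (2 ^ (4 ℕ.* j)) (s≤s (ℕ.≤-trans q≤ (ℕ.*-monoʳ-≤ c (ℕ.^-monoˡ-≤ d input-size)))) ⟩
    suc (c ℕ.* Y) ℕ.* 2 ^ (4 ℕ.* j)
      ≤⟨ ℕ.*-monoˡ-≤ (2 ^ (4 ℕ.* j)) (ℕ.+-monoˡ-≤ (c ℕ.* Y) 1≤Y) ⟩
    suc c ℕ.* Y ℕ.* 2 ^ (4 ℕ.* j)
      ≤⟨ ℕ.*-monoˡ-≤ (2 ^ (4 ℕ.* j)) (ℕ.*-monoˡ-≤ Y (ℕ.≤-trans (n<2^n c) (ℕ.^-monoˡ-≤ c 2≤u))) ⟩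
    u ^ c ℕ.* Y ℕ.* 2 ^ (4 ℕ.* j)
      ≡⟨ cong₂ (λ x y → u ^ c ℕ.* x ℕ.* y) (ℕ.^-*-assoc u 5 d)
           (trans (cong (2 ^_) (ℕ.*-comm 4 j)) (sym (ℕ.^-*-assoc 2 j 4))) ⟩
    u ^ c ℕ.* u ^ (5 ℕ.* d) ℕ.* u ^ 4
      ≡⟨ ℕ.*-assoc (u ^ c) (u ^ (5 ℕ.* d)) (u ^ 4) ⟩
    u ^ c ℕ.* (u ^ (5 ℕ.* d) ℕ.* u ^ 4)
      ≡⟨ trans (ℕ.^-distribˡ-+-* u c _) (cong (u ^ c ℕ.*_) (ℕ.^-distribˡ-+-* u (5 ℕ.* d) 4)) ⟨
    u ^ D
      ≡⟨ ℕ.^-*-assoc 2 j D ⟩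
    2 ^ β
      <⟨ ℕ.^-monoʳ-< 2 (s≤s (s≤s z≤n)) (ℕ.n<1+n β) ⟩
    2 ^ suc β ∎
    where
    Y : ℕ
    Y = (u ^ 5) ^ d
    2≤u : 2 ℕ.≤ u
    2≤u = subst (2 ℕ.≤_) ℓ≡ (s≤s (s≤s z≤n))
    1≤Y : 1 ℕ.≤ Y
    1≤Y = ℕ.m^n>0 (u ^ 5) {{ℕ.m^n≢0 u 5 {{ℕ.m^n≢0 2 j}}}} d

  -- By k = u j the left side is 4 u β. On the right, each of 1, u b and b is at most u β, which is
  -- positive; hence the factor 4.
  ratio-exceeded : ∀ b → b ℕ.≤ β → ¬ (4 ℕ.* D ℕ.* k ℕ.≤ suc (suc u ℕ.* b))
  ratio-exceeded b b≤β h = ℕ.<-irrefl refl (begin-strict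
    4 ℕ.* D ℕ.* k            ≤⟨ h ⟩
    1 ℕ.+ suc u ℕ.* b        ≤⟨ ℕ.+-mono-≤ 1≤uβ (ℕ.*-monoʳ-≤ (suc u) b≤β) ⟩
    u ℕ.* β ℕ.+ suc u ℕ.* β
      ≡⟨ solve 2 (λ u x → u :* x :+ (con 1 :+ u) :* x := con 2 :* (u :* x) :+ x) refl u β ⟩
    2 ℕ.* (u ℕ.* β) ℕ.+ β    ≤⟨ ℕ.+-monoʳ-≤ (2 ℕ.* (u ℕ.* β)) (ℕ.m≤n*m β u {{u≢0}}) ⟩
    2 ℕ.* (u ℕ.* β) ℕ.+ u ℕ.* β <⟨ ℕ.m<m+n _ 1≤uβ ⟩
    2 ℕ.* (u ℕ.* β) ℕ.+ u ℕ.* β ℕ.+ u ℕ.* β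
      ≡⟨ solve 3 (λ u j D → con 2 :* (u :* (j :* D)) :+ u :* (j :* D) :+ u :* (j :* D) := con 4 :* D :* (u :* j)) refl u j D ⟩
    4 ℕ.* D ℕ.* (u ℕ.* j)    ≡⟨ cong (λ x → 4 ℕ.* D ℕ.* (x ℕ.* j)) ℓ≡ ⟨
    4 ℕ.* D ℕ.* k            ∎)
    where
    u≢0 : ℕ.NonZero u
    u≢0 = ℕ.m^n≢0 2 j
    1≤uβ : 1 ℕ.≤ u ℕ.* β
    1≤uβ = ℕ.*-mono-≤ (ℕ.m^n>0 2 j) (ℕ.*-mono-≤ (s≤s (z≤n {N})) (exponent>0 c d))

  open ParallelPaths k r using (network)

  -- The run on the visible cost, whose queries are few, is fixed before R is chosen. The guarantee
  -- is then invoked for the hidden cost of that R.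
  no-approximation : ∀ A (α : ℕ → ℝ) δ →
    (∀ f → queries (cost f) (A network) ℕ.≤ c ℕ.* (n ℕ.+ k ℕ.* ℓ) ^ d) →
    HasApproximationFactor A α → 0ℚ ℚ.< δ → ⌜ 4 ℕ.* D ⌝ ℚ.* δ ≡ 1ℚ →
    ¬ (∣ α n ∣ ≤ fromℚ δ * √[n/logn] n)
  no-approximation A α δ bounded approx 0<δ Dδ≡1 α≤ = against hidden-R
    where
    Qs : List (Subset (k ℕ.* ℓ))
    Qs = transcript (cost (visibleCost k r)) (A network)

    Hides : Vec (Fin ℓ) k → Set
    Hides R = ∀ {Q} → Q ∈ Qs →
      size (ParallelPaths.grid k r Q) ℕ.≤ k ℕ.+ k → hits R (ParallelPaths.grid k r Q) ℕ.≤ β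

    hidden-R : ∃[ R ] Hides R
    hidden-R = hiding-place k r β (2 ^ (4 ℕ.* j)) growth′ Qs
      (subst (λ x → x ℕ.* 2 ^ (4 ℕ.* j) ℕ.< 2 ^ suc β)
        (sym (length-transcript (cost (visibleCost k r)) (A network)))
        (few-queries _ (bounded (visibleCost k r))))

    against : ¬ (∃[ R ] Hides R)
    against (R , hides) = ratio-exceeded b
      (ℕ.≤-trans (ParallelPaths.hidden-selection≤ k r R β) (ℕ.m⊓n≤m β k))
      (ratio-bound {a = α n} {k} {b} {4 ℕ.* D} {u} {n} {⌊log₂ n ⌋} δ 0<δ Dδ≡1 n≤uulog α≤
        (subst (λ x → fromℚ ⌜ x ⌝ ≤ α n * fromℚ ⌜ b ⌝)
          (fooled k r R β (A network) hides (proj₁ guarantee))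
          (proj₂ guarantee selection (ParallelPaths.selection-minCut k r R β zero))))
      where
      open ParallelPaths.Hidden k r R using (selection)
      b : ℕ
      b = ParallelPaths.hidden k r R β selection
      C : Subset (k ℕ.* ℓ)
      C = result (cost (hiddenCost k r R β)) (A network)
      guarantee : IsCut network C × (∀ C* → IsMinCut network (hiddenCost k r R β) C* →
        cost (hiddenCost k r R β) C ≤ α n * cost (hiddenCost k r R β) C*)
      guarantee = approx network (hiddenCost k r R β)

-- The contradiction for given c, d and α.

reciprocal : ∀ e → 0 ℕ.< e → ∃[ δ ] (0ℚ ℚ.< δ × ⌜ e ⌝ ℚ.* δ ≡ 1ℚ)
reciprocal e 0<e =
  scale ⌜ e ⌝ 1ℚ (ℚ.≰⇒> λ h → ℕ.<⇒≱ 0<e (⌜⌝-cancel-≤ {e} {0} h)) (ℚ.positive⁻¹ 1ℚ)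

theorem1 : ¬ (∃[ A ] (PolynomialTime A ×
    (∃[ α ] ((α ∈o √[n/logn]) × HasApproximationFactor A α))))
theorem1 (A , (c , d , bounded) , α , α∈o , approx) =
  -- δ = 1/(4 D) depends on the query bound alone, and the threshold N for this δ then determines
  -- the instance.
  let δ , 0<δ , eδ≡1 = reciprocal e (ℕ.*-mono-≤ {1} {4} (s≤s z≤n) (exponent>0 c d))
      N , small      = α∈o δ 0<δ
  in at N δ 0<δ eδ≡1 small (2 ^ suc N ∸ 2) (ℕ.m+[n∸m]≡n (ℕ.*-monoʳ-≤ 2 (ℕ.m^n>0 2 N)))
  where
  e : ℕ
  e = 4 ℕ.* exponent c d

  -- Keeping r variable gives the path length the form suc (suc r), which 2 ^ suc N has only up to
  -- `_≡_`.
  at : ∀ N δ → 0ℚ ℚ.< δ → ⌜ e ⌝ ℚ.* δ ≡ 1ℚ →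
    (∀ n → N ℕ.≤ n → ∣ α n ∣ ≤ fromℚ δ * √[n/logn] n) →
    ∀ r → ¬ (suc (suc r) ≡ 2 ^ suc N)
  at N δ 0<δ eδ≡1 small r ℓ≡ =
    no-approximation A α δ (bounded (ParallelPaths.network k r)) approx 0<δ eδ≡1 (small n N≤n)
    where open Parameters c d N r ℓ≡
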